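{- Let $G$ be any $2$-connected graph with at least two distinct connected $2$-partitions $P,Q\in P_2(G)$, neither of which has the empty set as a block, and let $n=|V(G)|$. Then the family of flip walks on $P_2(D_d(G))$, $d\ge 1$, is torpidly mixing. In particular, for all $d\ge1$, $\Phi(P_2(D_d(G)))\le (d+1)2^{ -d-1}$, $t_{mix}(1/4)\ge \frac{2^{d-1}}{d+1}$ for the flip walk on $P_2(D_d(G))$, and $|P_2(D_d(G))|\le 2^{|V(D_d(G))|}\le 2^{n+dn^2}$.
   Context: $P_2(H)$ is the set of ordered pairs $(A,B)$ of disjoint vertex sets with union $V(H)$, each inducing a connected subgraph. The doubled $d$-star construction $D_d(G)$ replaces each edge of $G$ by $d$ parallel edges and then subdivides each new edge once. Flip walk: put a graph structure on $P_2(H)$: for $(A,B)\in P_2(H)$ and $x\in V(H)$, the move to $(A\cup\{x\},B\setminus\{x\})$ is an edge if this lies in $P_2(H)$ (including when it equals $(A,B)$) and otherwise a self-loop at $(A,B)$; similarly for $(A\setminus\{x\},B\cup\{x\})$; this gives a $|V(H)|$-regular graph, and the flip walk is the lazy simple random walk on it. For a lazy random walk $M$ on a $\Delta$-regular graph $K$, the conductance is $\Phi(M)=\min_{U\subset V(K),\,|U|\le |V(K)|/2}\frac{|\partial_E U|}{2\Delta|U|}$, where $\partial_E U$ is the set of edges with exactly one endpoint in $U$. The mixing time is $t_{mix}(\epsilon)=\inf\{t:\max_x\|P^t\delta_x-\mu\|_{TV}\le\epsilon\}$ with $\mu$ stationary. A family of chains is torpidly mixing if there is an exponentially growing $f$ with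 $t_{mix}^M(1/4)\ge f(\log|M|)$ for all chains $M$ in the family, $|M|$ the size of the state space. -}

module Defs where

open import Data.Bool using (Bool; true; false; _∧_; _∨_; not; if_then_else_)
open import Data.Nat as ℕ using (ℕ; zero; suc; _+_; _*_)
open import Data.Fin as Fin using (Fin; _↑ˡ_; _↑ʳ_; combine)
open import Data.Fin.Properties using () renaming (_≟_ to _≟ᶠ_)
open import Data.List as List using (List; []; _∷_; _++_; map; length; foldr; allFin; concatMap; filter)
import Data.List.Relation.Unary.Any as Any
open import Data.List.Membership.Propositional using (_∈_)
open import Data.Vec as Vec using (Vec; []; _∷_; lookup; _[_]%=_)
open import Data.Vec.Properties using (≡-dec)
open import Data.Bool.ListAction using () renaming (any to anyL; all to allL)
open import Data.Bool.Properties using () renaming (_≟_ to _≟ᵇ_)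
open import Data.Product using (_×_; _,_; proj₁; proj₂; Σ)
open import Data.Integer using (+_)
open import Data.Rational as ℚ using (ℚ; 0ℚ; 1ℚ; _/_; _⊓_; ∣_∣; _-_)
open import Relation.Nullary using (¬_)
open import Relation.Nullary.Decidable using (isYes)
open import Relation.Binary.PropositionalEquality using (_≡_)
open import Function using (_∘_)

record Graph : Set where
  constructor mkGraph
  field
    size  : ℕ
    edges : List (Fin size × Fin size)
open Graph public

adj : (G : Graph) → Fin (size G) → Fin (size G) → Bool
adj G x y = anyL (λ e → (isYes (proj₁ e ≟ᶠ x) ∧ isYes (proj₂ e ≟ᶠ y))
                          ∨ (isYes (proj₁ e ≟ᶠ y) ∧ isYes (proj₂ e ≟ᶠ x))) (edges G)

Loopless : Graph → Set
Loopless G = ∀ e → e ∈ edges G → ¬ (proj₁ e ≡ proj₂ e)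

NoMultiEdges : Graph → Set
NoMultiEdges G = ∀ (i j : Fin (length (edges G))) → ¬ (i ≡ j) →
  let e = List.lookup (edges G) i ; f = List.lookup (edges G) j in
  ¬ (proj₁ e ≡ proj₁ f × proj₂ e ≡ proj₂ f) × ¬ (proj₁ e ≡ proj₂ f × proj₂ e ≡ proj₁ f)

Simple : Graph → Set
Simple G = Loopless G × NoMultiEdges G

VSet : ℕ → Set
VSet N = Vec Bool N

_∈ᵇ_ : ∀ {N} → Fin N → VSet N → Bool
x ∈ᵇ S = lookup S x

complement : ∀ {N} → VSet N → VSet N
complement = Vec.map not

allSubsets : (N : ℕ) → List (VSet N)
allSubsets zero    = [] ∷ []
allSubsets (suc N) = map (true ∷_) (allSubsets N) ++ map (false ∷_) (allSubsets N)

anyFin : (N : ℕ) → (Fin N → Bool) → Bool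
anyFin N p = anyL p (allFin N)

allFinᵇ : (N : ℕ) → (Fin N → Bool) → Bool
allFinᵇ N p = allL p (allFin N)

reachIn : (G : Graph) → VSet (size G) → ℕ → Fin (size G) → Fin (size G) → Bool
reachIn G S zero    x y = isYes (x ≟ᶠ y) ∧ (x ∈ᵇ S)
reachIn G S (suc k) x y = reachIn G S k x y
  ∨ anyFin (size G) (λ z → reachIn G S k x z ∧ adj G z y ∧ (y ∈ᵇ S))

-- S induces a connected subgraph of G (the empty set counts as connected;
-- a walk of length ≤ |V(G)| suffices whenever a walk exists)
connectedᵇ : (G : Graph) → VSet (size G) → Bool
connectedᵇ G S = allFinᵇ (size G) λ x → allFinᵇ (size G) λ y →
  not (x ∈ᵇ S ∧ y ∈ᵇ S) ∨ reachIn G S (size G) x y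

Connected : (G : Graph) → VSet (size G) → Set
Connected G S = connectedᵇ G S ≡ true

allV : (N : ℕ) → VSet N
allV N = Vec.replicate N true

TwoConnected : Graph → Set
TwoConnected G = (3 ℕ.≤ size G) × Connected G (allV (size G))
  × (∀ v → Connected G (allV (size G) [ v ]%= (λ _ → false)))

-- Connected 2-partitions.  (A , B) ∈ P₂(H) is encoded by A; B = V ∖ A.

isP2 : (G : Graph) → VSet (size G) → Bool
isP2 G A = connectedᵇ G A ∧ connectedᵇ G (complement A)

InP2 : (G : Graph) → VSet (size G) → Set
InP2 G A = isP2 G A ≡ true

P2 : (G : Graph) → List (VSet (size G))
P2 G = filter (λ A → isP2 G A ≟ᵇ true) (allSubsets (size G))

BlocksNonempty : (G : Graph) → VSet (size G) → Set
BlocksNonempty G A = anyFin (size G) (λ x → x ∈ᵇ A) ≡ true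
                   × anyFin (size G) (λ x → not (x ∈ᵇ A)) ≡ true

-- The doubled d-star construction D_d(G): each edge e_j = (u,v) of G is
-- replaced by d parallel edges, each subdivided once by a new vertex
-- s(j,i), i < d, adjacent to u and v.
-- Vertices: Fin (n + m * d), original vertex u ↦ u ↑ˡ (m*d),
-- subdivision vertex s(j,i) ↦ n ↑ʳ combine j i.

D : ℕ → Graph → Graph
D d G = mkGraph (n + m * d) newEdges
  where
  n = size G
  m = length (edges G)
  orig : Fin n → Fin (n + m * d)
  orig u = u ↑ˡ (m * d)
  sub : Fin m → Fin d → Fin (n + m * d)
  sub j i = n ↑ʳ combine j i
  newEdges : List (Fin (n + m * d) × Fin (n + m * d))
  newEdges = concatMap (λ j → concatMap (λ i →
      (orig (proj₁ (List.lookup (edges G) j)) , sub j i)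
    ∷ (sub j i , orig (proj₂ (List.lookup (edges G) j)))
    ∷ []) (allFin d)) (allFin m)

recip : ℕ → ℚ
recip zero    = 0ℚ
recip (suc k) = + 1 / suc k

fromℕ : ℕ → ℚ
fromℕ k = + k / 1

sumℚ : List ℚ → ℚ
sumℚ = foldr ℚ._+_ 0ℚ

-- The flip walk on P₂(H).  The state graph K is |V(H)|-regular: for
-- every state A and every vertex x there is one edge, to A △ {x} if this
-- lies in P₂(H), and a self-loop at A otherwise.  The flip walk is the lazy
-- simple random walk on K.

flipV : ∀ {N} → VSet N → Fin N → VSet N
flipV A x = A [ x ]%= not

_≟ⱽ_ : ∀ {N} (A B : VSet N) → Bool
A ≟ⱽ B = isYes (≡-dec _≟ᵇ_ A B)

Dist : Graph → Set
Dist H = VSet (size H) → ℚ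

-- one step of the lazy walk applied to a distribution μ (the chain is
-- symmetric, so (μP)(A) = Σ_B μ(B) P(B,A) = Σ_B P(A,B) μ(B))
step : (H : Graph) → Dist H → Dist H
step H μ A = recip 2 ℚ.* μ A ℚ.+ recip (2 * size H) ℚ.*
  sumℚ (map (λ x → if isP2 H (flipV A x) then μ (flipV A x) else μ A) (allFin (size H)))

iter : (H : Graph) → ℕ → Dist H → Dist H
iter H zero    μ = μ
iter H (suc t) μ = step H (iter H t μ)

δ : (H : Graph) → VSet (size H) → Dist H
δ H X A = if A ≟ⱽ X then 1ℚ else 0ℚ

uniform : (H : Graph) → Dist H
uniform H A = recip (length (P2 H))

TV : (H : Graph) → Dist H → Dist H → ℚ
TV H p q = recip 2 ℚ.* sumℚ (map (λ A → ∣ p A - q A ∣) (P2 H))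

MixedBy : (H : Graph) → ℚ → ℕ → Set
MixedBy H ε t = ∀ X → X ∈ P2 H → TV H (iter H t (δ H X)) (uniform H) ℚ.≤ ε

-- t_mix(ε) ≥ b  ⇔  every t with max_x ‖P^t δ_x − μ‖ ≤ ε satisfies t ≥ b
-- (t_mix(ε) is the infimum of this set of times)
MixingTimeAtLeast : (H : Graph) → ℚ → ℚ → Set
MixingTimeAtLeast H ε b = ∀ t → MixedBy H ε t → b ℚ.≤ fromℕ t

-- Conductance Φ = min over U ⊆ P₂(H), U ≠ ∅, |U| ≤ |P₂(H)|/2 of
-- |∂_E U| / (2Δ|U|), with Δ = |V(H)|.

sublists : {A : Set} → List A → List (List A)
sublists []       = [] ∷ []
sublists (x ∷ xs) = map (x ∷_) (sublists xs) ++ sublists xs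

memᵇ : ∀ {N} → VSet N → List (VSet N) → Bool
memᵇ A U = anyL (A ≟ⱽ_) U

-- number of edges of K with exactly one endpoint in U (each counted from
-- its endpoint in U; self-loops never count)
boundary : (H : Graph) → List (VSet (size H)) → ℕ
boundary H U = length (filter (λ b → b ≟ᵇ true)
  (concatMap (λ A → map (λ x → isP2 H (flipV A x) ∧ not (memᵇ (flipV A x) U))
                        (allFin (size H))) U))

admissible : (H : Graph) → List (VSet (size H)) → Bool
admissible H U = not (isYes (length U ℕ.≟ 0))
  ∧ isYes (2 * length U ℕ.≤? length (P2 H))

ratio : (H : Graph) → List (VSet (size H)) → ℚ
ratio H U = fromℕ (boundary H U) ℚ.* recip (2 * size H * length U)

-- minimum over the admissible U (every ratio is ≤ 1/2, so the seed 1 is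
-- never the minimum when an admissible U exists)
conductance : (H : Graph) → ℚ
conductance H = foldr _⊓_ 1ℚ
  (map (ratio H) (filter (λ U → admissible H U ≟ᵇ true) (sublists (P2 H))))

-- Torpid mixing of the family (flip walk on P₂(D_d(G)))_{d ≥ 1}:
-- there is an exponentially growing f, f(x) = c·e^{x/k} (c > 0, k ≥ 1),
-- with t_mix(1/4) ≥ f(log|M|) = c·|M|^{1/k}, i.e. (absorbing constants) t^k ≥ c·|M| for every
-- t ≥ t_mix(1/4).
TorpidFamily : (ℕ → Graph) → Set
TorpidFamily H = Σ ℕ λ k → Σ ℚ λ c → (1 ℕ.≤ k) × (0ℚ ℚ.< c) ×
  (∀ d → 1 ℕ.≤ d → ∀ t → MixedBy (H d) (recip 4) t →
     c ℚ.* fromℕ (length (P2 (H d))) ℚ.≤ fromℕ (t ℕ.^ k))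

{-# OPTIONS --safe #-}
module Submission where

-- The bottleneck is the set U of all states whose trace on V(G) is P; of the two such fibres, over P and
-- over Q, the smaller one has at most half of all states.  Membership in U does not change when a
-- subdivision vertex of a cut edge of P switches sides, because such a vertex is a leaf on either side.
-- A flip leaving U moves some v ∈ V(G).  Afterwards v must have a neighbour on its new side, which forces
-- v to be on a cut edge of P; and both ends of that edge are now together, so at most one of its d
-- subdivision vertices is left on the old side of v.  By the free switching this has probability
-- (d+1)/2^d in U, which gives the conductance.
-- For the mixing time, start the walk with mass 1 at every state of U.  All masses stay in [0,1], so each
-- step moves at most |∂U|/(2Δ) out of U, whereas a walk mixed up to 1/4 has lost mass 1/4 from each of its
-- starting points, as U has at most half of all states.

open import Defs
open import Data.Bool using (Bool; true; false; _∧_; _∨_; not; T; if_then_else_)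
open import Data.Bool.Properties using (T-≡; not-involutive; ∧-identityʳ; ∧-assoc; ∧-comm; ∧-zeroʳ; ¬-not; if-float) renaming (_≟_ to _≟ᵇ_)
open import Data.Empty using (⊥; ⊥-elim)
open import Data.Fin as Fin using (Fin; zero; suc; _↑ˡ_; _↑ʳ_; combine; remQuot; splitAt)
import Data.Fin.Properties as Finₚ
open import Data.Integer as ℤ using () renaming (+_ to pos)
import Data.Integer.Properties as ℤₚ
open import Data.List as List using (List; []; _∷_; _++_; map; length; allFin; filter; concatMap)
open import Data.List.Membership.Propositional using (_∈_)
import Data.List.Membership.Propositional.Properties as Memₚ
import Data.List.Properties as Listₚ
open import Data.List.Relation.Binary.Permutation.Propositional using (_↭_; ↭-trans; ↭-reflexive; ↭⇒↭ₛ)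
import Data.List.Relation.Binary.Permutation.Propositional.Properties as ↭ₚ
open import Data.List.Relation.Unary.All as All using (All; []; _∷_)
import Data.List.Relation.Unary.All.Properties as Allₚ
open import Data.List.Relation.Unary.AllPairs using ([]; _∷_)
open import Data.List.Relation.Unary.Any as Any using (Any; here; there)
import Data.List.Relation.Unary.Any.Properties as Anyₚ
open import Data.List.Relation.Unary.Unique.Propositional using (Unique)
import Data.List.Relation.Unary.Unique.Propositional.Properties as Uniqueₚ
open import Data.Nat as ℕ using (ℕ; zero; suc; _+_; _*_; _^_; _∸_; _≤_; _<_; z≤n; s≤s)
open import Data.Nat.ListAction using (sum)
import Data.Nat.Properties as ℕₚ
open import Data.Nat.Solver using (module +-*-Solver)
open import Data.Product using (Σ; ∃; ∃₂; _×_; _,_; proj₁; proj₂)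
open import Data.Rational as ℚ using (ℚ; 0ℚ; 1ℚ; ∣_∣; _-_; -_; toℚᵘ; nonNegative; _⊓_) renaming (_+_ to _+ℚ_; _*_ to _*ℚ_; _≤_ to _≤ℚ_; _<_ to _<ℚ_)
import Data.Rational.Properties as ℚₚ
open import Data.Rational.Solver using () renaming (module +-*-Solver to ℚ-Solver)
import Data.Rational.Unnormalised as ℚᵘ
import Data.Rational.Unnormalised.Properties as ℚᵘₚ
open import Data.Sum using (_⊎_; inj₁; inj₂)
open import Data.Vec as Vec using ([]; _∷_; lookup)
import Data.Vec.Properties as Vecₚ
open import Function using (_∘_; id)
open import Function.Bundles using (Equivalence)
open import Relation.Nullary using (¬_; Dec; yes; no; contradiction)
open import Relation.Nullary.Decidable using (isYes; _×-dec_; _⊎-dec_)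
open import Relation.Binary.Construct.Closure.ReflexiveTransitive as Star using (Star; ε; _◅_; _◅◅_)
open import Relation.Binary.PropositionalEquality
open import Data.List.Relation.Binary.Permutation.Setoid.Properties (setoid ℚ) using (foldr-commMonoid)

open Equivalence using (to; from)

-- The switching is used as a symmetry of the fibre: for each subdivision vertex of a cut edge, the
-- flip is an involution that preserves the fibre. So all `2 ^ d` placements of the `d` subdivision
-- vertices of one cut edge are equally frequent in it, and `d + 1` of these placements have at most
-- one vertex on a prescribed side. A flip need not map `P2 H` to itself, but it always permutes the
-- cube of all vertex sets; therefore counts and sums run over the cube, with membership as a
-- predicate.
--
-- For torpid mixing, `n` and the number `m` of edges of `G` stay fixed while `d` grows. There are
-- at most `2 ^ (n + m * d)` states, so the logarithm of their number is at most linear in `d`. From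
-- `(d + 1)² ≤ 4 * 2 ^ d` the bound on the mixing time becomes `2 ^ d ≤ 16 * t²`, and raising this
-- to the power `m + 1` bounds the number of states by a constant times `t ^ (2 * (m + 1))`.

∧-true⁻ : ∀ {x y} → x ∧ y ≡ true → x ≡ true × y ≡ true
∧-true⁻ {true} e = refl , e

∨-true⁻ : ∀ {x y} → x ∨ y ≡ true → x ≡ true ⊎ y ≡ true
∨-true⁻ {true}  _ = inj₁ refl
∨-true⁻ {false} e = inj₂ e

∨-true⁺ʳ : ∀ x {y} → y ≡ true → x ∨ y ≡ true
∨-true⁺ʳ true  _ = refl
∨-true⁺ʳ false e = e

not-true⁻ : ∀ {x} → not x ≡ true → x ≡ false
not-true⁻ {false} _ = refl

≡not⇒≢ : ∀ {x b} → x ≡ not b → ¬ x ≡ b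
≡not⇒≢ {b = true}  refl ()
≡not⇒≢ {b = false} refl ()

≢⇒≡not : ∀ {x b} → ¬ x ≡ b → x ≡ not b
≢⇒≡not {true}  {true}  ne = ⊥-elim (ne refl)
≢⇒≡not {true}  {false} ne = refl
≢⇒≡not {false} {true}  ne = refl
≢⇒≡not {false} {false} ne = ⊥-elim (ne refl)

isYes-true⁻ : ∀ {A : Set} (d : Dec A) → isYes d ≡ true → A
isYes-true⁻ (yes a) _ = a

isYes-true⁺ : ∀ {A : Set} (d : Dec A) → A → isYes d ≡ true
isYes-true⁺ (yes _)  _ = refl
isYes-true⁺ (no ¬a) a = ⊥-elim (¬a a)

anyFin⁺ : ∀ {n} (p : Fin n → Bool) i → p i ≡ true → anyFin n p ≡ true
anyFin⁺ p i e = to T-≡ (Anyₚ.any⁺ p (Anyₚ.tabulate⁺ i (from T-≡ e)))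

anyFin⁻ : ∀ {n} (p : Fin n → Bool) → anyFin n p ≡ true → ∃ λ i → p i ≡ true
anyFin⁻ {n} p e with Anyₚ.tabulate⁻ (Anyₚ.any⁻ p (allFin n) (from T-≡ e))
... | i , h = i , to T-≡ h

anyFin-false : ∀ {n} {p : Fin n → Bool} → anyFin n p ≡ false → ∀ i → p i ≡ false
anyFin-false {p = p} e i with p i in e'
... | false = refl
... | true  = trans (sym (anyFin⁺ p i e')) e

allFinᵇ⁺ : ∀ {n} {p : Fin n → Bool} → (∀ i → p i ≡ true) → allFinᵇ n p ≡ true
allFinᵇ⁺ {p = p} h = to T-≡ (Allₚ.all⁻ p (Allₚ.tabulate⁺ λ i → from T-≡ (h i)))

allFinᵇ⁻ : ∀ {n} {p : Fin n → Bool} → allFinᵇ n p ≡ true → ∀ i → p i ≡ true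
allFinᵇ⁻ {n} {p} e i = to T-≡ (Allₚ.tabulate⁻ (Allₚ.all⁺ p (allFin n) (from T-≡ e)) i)

-- Connectivity

Joins : ∀ {n} → Fin n → Fin n → Fin n × Fin n → Set
Joins x y e = (proj₁ e ≡ x × proj₂ e ≡ y) ⊎ (proj₁ e ≡ y × proj₂ e ≡ x)

Adjacent : (G : Graph) → Fin (size G) → Fin (size G) → Set
Adjacent G x y = Any (Joins x y) (edges G)

Joins-sym : ∀ {n} {x y : Fin n} {e} → Joins x y e → Joins y x e
Joins-sym (inj₁ h) = inj₂ h
Joins-sym (inj₂ h) = inj₁ h

Adjacent-sym : ∀ {G x y} → Adjacent G x y → Adjacent G y x
Adjacent-sym {G} {x} {y} = Any.map (λ {e} → Joins-sym {x = x} {y} {e})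

adj⁻ : ∀ G {x y} → adj G x y ≡ true → Adjacent G x y
adj⁻ G {x} {y} e = Any.map joins (Anyₚ.any⁻ _ (edges G) (from T-≡ e))
  where
  joins : ∀ {e} → T _ → Joins x y e
  joins {u , v} h with ∨-true⁻ (to T-≡ h)
  ... | inj₁ k = inj₁ (isYes-true⁻ (u Finₚ.≟ x) (proj₁ (∧-true⁻ k)) , isYes-true⁻ (v Finₚ.≟ y) (proj₂ (∧-true⁻ k)))
  ... | inj₂ k = inj₂ (isYes-true⁻ (u Finₚ.≟ y) (proj₁ (∧-true⁻ k)) , isYes-true⁻ (v Finₚ.≟ x) (proj₂ (∧-true⁻ k)))

adj⁺ : ∀ G {x y} → Adjacent G x y → adj G x y ≡ true
adj⁺ G {x} {y} a = to T-≡ (Anyₚ.any⁺ _ (Any.map (from T-≡ ∘ joins) a))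
  where
  joins : ∀ {e} → Joins x y e →
    (isYes (proj₁ e Finₚ.≟ x) ∧ isYes (proj₂ e Finₚ.≟ y)) ∨ (isYes (proj₁ e Finₚ.≟ y) ∧ isYes (proj₂ e Finₚ.≟ x)) ≡ true
  joins {e} (inj₁ (refl , refl)) = cong₂ (λ a b → (a ∧ b) ∨ (isYes (proj₁ e Finₚ.≟ proj₂ e) ∧ isYes (proj₂ e Finₚ.≟ proj₁ e))) (isYes-true⁺ (x Finₚ.≟ x) refl) (isYes-true⁺ (y Finₚ.≟ y) refl)
  joins (inj₂ (refl , refl)) = ∨-true⁺ʳ _ (cong₂ _∧_ (isYes-true⁺ (y Finₚ.≟ y) refl) (isYes-true⁺ (x Finₚ.≟ x) refl))

-- The parameter `b` names the block, so one argument serves both blocks and `complement` disappears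
-- once `isP2` has been translated. Only links carry membership: an empty walk says nothing about
-- its endpoint, which is why membership of endpoints is often passed along separately.
Link : (G : Graph) → VSet (size G) → Bool → Fin (size G) → Fin (size G) → Set
Link G A b x y = Adjacent G x y × lookup A x ≡ b × lookup A y ≡ b

Walk : (G : Graph) → VSet (size G) → Bool → Fin (size G) → Fin (size G) → Set
Walk G A b = Star (Link G A b)

walk-sym : ∀ G A {b x y} → Walk G A b x y → Walk G A b y x
walk-sym G A = Star.reverse λ (a , p , q) → Adjacent-sym {G} a , q , p

SideConnected : (G : Graph) → VSet (size G) → Bool → Set
SideConnected G A b = ∀ x y → lookup A x ≡ b → lookup A y ≡ b → Walk G A b x y

reachIn-suc⁻ : ∀ G S k x {y} → reachIn G S (suc k) x y ≡ true → reachIn G S k x y ≡ true ⊎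
  (∃ λ z → reachIn G S k x z ≡ true × Adjacent G z y × lookup S y ≡ true)
reachIn-suc⁻ G S k x {y} e with ∨-true⁻ {reachIn G S k x y} e
... | inj₁ e₁ = inj₁ e₁
... | inj₂ e₂ with anyFin⁻ (λ z → reachIn G S k x z ∧ adj G z y ∧ (y ∈ᵇ S)) e₂
... | z , e₃ with ∧-true⁻ e₃
... | e₄ , e₅ with ∧-true⁻ e₅
... | e₆ , e₇ = inj₂ (z , e₄ , adj⁻ G e₆ , e₇)

reachIn-suc⁺ : ∀ G S k x {y z} → reachIn G S k x z ≡ true → Adjacent G z y → lookup S y ≡ true →
  reachIn G S (suc k) x y ≡ true
reachIn-suc⁺ G S k x {y} {z} e a y∈S = ∨-true⁺ʳ (reachIn G S k x y)
  (anyFin⁺ (λ z → reachIn G S k x z ∧ adj G z y ∧ (y ∈ᵇ S)) z (cong₂ _∧_ e (cong₂ _∧_ (adj⁺ G a) y∈S)))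

reachIn⇒walk : ∀ G {S x} k {y} → reachIn G S k x y ≡ true → Walk G S true x y × lookup S y ≡ true
reachIn⇒walk G {S} {x} zero {y} e with ∧-true⁻ e
... | e₁ , e₂ with isYes-true⁻ (x Finₚ.≟ y) e₁
... | refl = ε , e₂
reachIn⇒walk G {S} {x} (suc k) {y} e with reachIn-suc⁻ G S k x e
... | inj₁ e₁ = reachIn⇒walk G k e₁
... | inj₂ (z , e₂ , a , y∈S) with reachIn⇒walk G k e₂
... | w , z∈S = w ◅◅ ((a , z∈S , y∈S) ◅ ε) , y∈S

sizeᵇ : ∀ {n} → (Fin n → Bool) → ℕ
sizeᵇ {zero}  p = 0
sizeᵇ {suc n} p = (if p zero then 1 else 0) + sizeᵇ (p ∘ suc)

sizeᵇ≤n : ∀ {n} (p : Fin n → Bool) → sizeᵇ p ≤ n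
sizeᵇ≤n {zero}  p = z≤n
sizeᵇ≤n {suc n} p with p zero
... | true  = s≤s (sizeᵇ≤n (p ∘ suc))
... | false = ℕₚ.m≤n⇒m≤1+n (sizeᵇ≤n (p ∘ suc))

sizeᵇ-mono : ∀ {n} {p q : Fin n → Bool} → (∀ i → p i ≡ true → q i ≡ true) → sizeᵇ p ≤ sizeᵇ q
sizeᵇ-mono {zero}  p⇒q = z≤n
sizeᵇ-mono {suc n} {p} {q} p⇒q with p zero in e₁ | q zero in e₂
... | true  | true  = s≤s (sizeᵇ-mono (p⇒q ∘ suc))
... | true  | false = contradiction (trans (sym (p⇒q zero e₁)) e₂) λ ()
... | false | true  = ℕₚ.m≤n⇒m≤1+n (sizeᵇ-mono (p⇒q ∘ suc))
... | false | false = sizeᵇ-mono (p⇒q ∘ suc)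

sizeᵇ-strict : ∀ {n} {p q : Fin n → Bool} → (∀ i → p i ≡ true → q i ≡ true) →
  ∀ i → p i ≡ false → q i ≡ true → sizeᵇ p < sizeᵇ q
sizeᵇ-strict {suc n} {p} {q} p⇒q zero pi qi rewrite pi | qi = s≤s (sizeᵇ-mono (p⇒q ∘ suc))
sizeᵇ-strict {suc n} {p} {q} p⇒q (suc i) pi qi with p zero in e₁ | q zero in e₂
... | true  | true  = s≤s (sizeᵇ-strict (p⇒q ∘ suc) i pi qi)
... | true  | false = contradiction (trans (sym (p⇒q zero e₁)) e₂) λ ()
... | false | true  = ℕₚ.m≤n⇒m≤1+n (sizeᵇ-strict (p⇒q ∘ suc) i pi qi)
... | false | false = sizeᵇ-strict (p⇒q ∘ suc) i pi qi

-- The sets reached in k steps grow strictly until they are closed under taking neighbours in S.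
module Saturation (G : Graph) (S : VSet (size G)) (x : Fin (size G)) (x∈S : lookup S x ≡ true) where

  Closed : ℕ → Set
  Closed k = ∀ y → reachIn G S (suc k) x y ≡ true → reachIn G S k x y ≡ true

  reachIn-suc : ∀ k y → reachIn G S k x y ≡ true → reachIn G S (suc k) x y ≡ true
  reachIn-suc k y e rewrite e = refl

  closed-suc : ∀ k → Closed k → Closed (suc k)
  closed-suc k c y e with reachIn-suc⁻ G S (suc k) x e
  ... | inj₁ e₁ = e₁
  ... | inj₂ (z , e₂ , a , y∈S) = reachIn-suc⁺ G S k x (c z e₂) a y∈S

  fresh : ℕ → Fin (size G) → Bool
  fresh k y = not (reachIn G S k x y) ∧ reachIn G S (suc k) x y

  closed? : ∀ k → Closed k ⊎ (∃ λ y → reachIn G S k x y ≡ false × reachIn G S (suc k) x y ≡ true)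
  closed? k with anyFin (size G) (fresh k) in e
  ... | true with anyFin⁻ (fresh k) e
  ...   | y , h = inj₂ (y , not-true⁻ (proj₁ (∧-true⁻ h)) , proj₂ (∧-true⁻ h))
  closed? k | false = inj₁ λ y h → not-fresh (anyFin-false e y) h
    where
    not-fresh : ∀ {a b} → not a ∧ b ≡ false → b ≡ true → a ≡ true
    not-fresh {true} _ _ = refl
    not-fresh {false} f t = trans (sym f) t

  -- The strict inequality is gained at `k = 0`, where `x` itself is already reached. At
  -- `k = size G` the second alternative would need more vertices than there are.
  closed-or-large : ∀ k → Closed k ⊎ k < sizeᵇ (reachIn G S k x)
  closed-or-large zero = inj₂ (ℕₚ.≤-trans (s≤s z≤n)
    (sizeᵇ-strict {p = λ _ → false} (λ _ ()) x refl (cong₂ _∧_ (isYes-true⁺ (x Finₚ.≟ x) refl) x∈S)))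
  closed-or-large (suc k) with closed-or-large k | closed? k
  ... | inj₁ c | _      = inj₁ (closed-suc k c)
  ... | inj₂ _ | inj₁ c = inj₁ (closed-suc k c)
  ... | inj₂ l | inj₂ (y , e , e') = inj₂ (ℕₚ.≤-trans (s≤s l) (sizeᵇ-strict (reachIn-suc k) y e e'))

  closed-size : Closed (size G)
  closed-size with closed-or-large (size G)
  ... | inj₁ c = c
  ... | inj₂ l = ⊥-elim (ℕₚ.<⇒≱ l (sizeᵇ≤n _))

  start : ∀ k → reachIn G S k x x ≡ true
  start zero    = cong₂ _∧_ (isYes-true⁺ (x Finₚ.≟ x) refl) x∈S
  start (suc k) = reachIn-suc k x (start k)

  -- The set reached after `size G` steps is closed, so a walk of any length stays inside it and
  -- never has to be shortened.
  extend : ∀ {z y} → reachIn G S (size G) x z ≡ true → Walk G S true z y → reachIn G S (size G) x y ≡ true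
  extend e ε = e
  extend {z} e ((a , _ , y∈S) ◅ w) = extend (closed-size _ (reachIn-suc⁺ G S (size G) x e a y∈S)) w

connected⇒walk : ∀ G {S} → Connected G S → SideConnected G S true
connected⇒walk G {S} c x y x∈S y∈S = proj₁ (reachIn⇒walk G (size G)
  (trans (sym (cong₂ (λ a b → not (a ∧ b) ∨ reachIn G S (size G) x y) x∈S y∈S)) (allFinᵇ⁻ (allFinᵇ⁻ c x) y)))

walk⇒connected : ∀ G {S} → SideConnected G S true → Connected G S
walk⇒connected G {S} c = allFinᵇ⁺ λ x → allFinᵇ⁺ λ y → pair x y
  where
  pair : ∀ x y → not (lookup S x ∧ lookup S y) ∨ reachIn G S (size G) x y ≡ true
  pair x y with lookup S x in ex | lookup S y in ey
  ... | false | _     = refl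
  ... | true  | false = refl
  ... | true  | true  = extend (start (size G)) (c x y ex ey)
    where open Saturation G S x ex

lookup-complement⁺ : ∀ {n} (A : VSet n) x → lookup A x ≡ false → lookup (complement A) x ≡ true
lookup-complement⁺ A x e = trans (Vecₚ.lookup-map x not A) (cong not e)

lookup-complement⁻ : ∀ {n} (A : VSet n) x → lookup (complement A) x ≡ true → lookup A x ≡ false
lookup-complement⁻ A x e = not-true⁻ (trans (sym (Vecₚ.lookup-map x not A)) e)

P2⇒sides : ∀ G A → InP2 G A → ∀ b → SideConnected G A b
P2⇒sides G A p true  = connected⇒walk G (proj₁ (∧-true⁻ p))
P2⇒sides G A p false x y ex ey =
  Star.map (λ (a , p , q) → a , lookup-complement⁻ A _ p , lookup-complement⁻ A _ q)
    (connected⇒walk G (proj₂ (∧-true⁻ p)) x y (lookup-complement⁺ A x ex) (lookup-complement⁺ A y ey))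

sides⇒P2 : ∀ G A → (∀ b → SideConnected G A b) → InP2 G A
sides⇒P2 G A c = cong₂ _∧_ (walk⇒connected G (c true)) (walk⇒connected G λ x y ex ey →
  Star.map (λ (a , p , q) → a , lookup-complement⁺ A _ p , lookup-complement⁺ A _ q)
    (c false x y (lookup-complement⁻ A x ex) (lookup-complement⁻ A y ey)))

lookup-flip : ∀ {N} (A : VSet N) x → lookup (flipV A x) x ≡ not (lookup A x)
lookup-flip A x = Vecₚ.lookup∘updateAt x A

lookup-flip-≢ : ∀ {N} (A : VSet N) {x y} → y ≢ x → lookup (flipV A x) y ≡ lookup A y
lookup-flip-≢ A {x} {y} y≢x = Vecₚ.lookup∘updateAt′ y x y≢x A

-- The first link of a walk to `y` is the neighbour. The analysis of flips of original vertices uses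
-- connectivity only in this form.
not-isolated : ∀ G A {b x y} → SideConnected G A b → lookup A x ≡ b → lookup A y ≡ b → x ≢ y →
  ∃ λ z → Adjacent G x z × lookup A z ≡ b
not-isolated G A {x = x} {y} c ex ey x≢y with c x y ex ey
... | ε                   = ⊥-elim (x≢y refl)
... | (a , _ , ez) ◅ _    = _ , a , ez

hub⇒connected : ∀ G A {b} h → (∀ y → lookup A y ≡ b → Walk G A b h y) → SideConnected G A b
hub⇒connected G A h w x y ex ey = walk-sym G A (w x ex) ◅◅ w y ey

-- The doubled star: adjacency, and how flips affect connectivity

module Star-of (G : Graph) (d : ℕ) where

  n m : ℕ
  n = size G
  m = length (edges G)

  H : Graph
  H = D d G

  src tgt : Fin m → Fin n
  src j = proj₁ (List.lookup (edges G) j)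
  tgt j = proj₂ (List.lookup (edges G) j)

  orig : Fin n → Fin (size H)
  orig u = u ↑ˡ (m * d)

  sub : Fin m → Fin d → Fin (size H)
  sub j i = n ↑ʳ combine j i

  data Vertex : Fin (size H) → Set where
    original    : ∀ u → Vertex (orig u)
    subdivision : ∀ j i → Vertex (sub j i)

  vertex : ∀ x → Vertex x
  vertex x with splitAt n x in e
  ... | inj₁ u = subst Vertex (Finₚ.splitAt⁻¹-↑ˡ e) (original u)
  ... | inj₂ k = subst Vertex (trans (cong (n ↑ʳ_) (Finₚ.combine-remQuot {m} d k)) (Finₚ.splitAt⁻¹-↑ʳ e))
                   (subdivision (proj₁ (remQuot d k)) (proj₂ (remQuot {m} d k)))

  orig≢sub : ∀ {u j i} → orig u ≢ sub j i
  orig≢sub {u} {j} {i} e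
    with trans (sym (Finₚ.splitAt-↑ˡ n u (m * d))) (trans (cong (splitAt n) e) (Finₚ.splitAt-↑ʳ n (m * d) (combine j i)))
  ... | ()

  orig-injective : ∀ {u v} → orig u ≡ orig v → u ≡ v
  orig-injective {u} {v} = Finₚ.↑ˡ-injective (m * d) u v

  sub-injective : ∀ {j j' i i'} → sub j i ≡ sub j' i' → j ≡ j' × i ≡ i'
  sub-injective {j} {j'} {i} {i'} e = Finₚ.combine-injective j i j' i' (Finₚ.↑ʳ-injective n _ _ e)

  IsEnd : Fin m → Fin n → Set
  IsEnd j u = src j ≡ u ⊎ tgt j ≡ u

  isEnd-cases : ∀ {j u v w} → IsEnd j v → IsEnd j w → v ≢ w → IsEnd j u → u ≡ v ⊎ u ≡ w
  isEnd-cases (inj₁ p) (inj₁ q) v≢w _ = ⊥-elim (v≢w (trans (sym p) q))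
  isEnd-cases (inj₂ p) (inj₂ q) v≢w _ = ⊥-elim (v≢w (trans (sym p) q))
  isEnd-cases (inj₁ p) (inj₂ q) _ (inj₁ r) = inj₁ (trans (sym r) p)
  isEnd-cases (inj₁ p) (inj₂ q) _ (inj₂ r) = inj₂ (trans (sym r) q)
  isEnd-cases (inj₂ p) (inj₁ q) _ (inj₁ r) = inj₂ (trans (sym r) q)
  isEnd-cases (inj₂ p) (inj₁ q) _ (inj₂ r) = inj₁ (trans (sym r) p)

  adjacent⁺ : ∀ {j u} i → IsEnd j u → Adjacent H (orig u) (sub j i)
  adjacent⁺ {j} i e = Anyₚ.concatMap⁺ _ (Anyₚ.tabulate⁺ j (Anyₚ.concatMap⁺ _ (Anyₚ.tabulate⁺ i (incident e))))
    where
    incident : ∀ {u} → IsEnd j u → Any (Joins (orig u) (sub j i)) ((orig (src j) , sub j i) ∷ (sub j i , orig (tgt j)) ∷ [])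
    incident (inj₁ refl) = here (inj₁ (refl , refl))
    incident (inj₂ refl) = there (here (inj₂ (refl , refl)))

  -- The doubled star is bipartite between original and subdivision vertices. As `orig` and `sub`
  -- are functions and not constructors, the lemmas that read off neighbours take the known endpoint
  -- as an equation instead of matching on an index.
  data Incidence : Fin (size H) → Fin (size H) → Set where
    out  : ∀ {j u} i → IsEnd j u → Incidence (orig u) (sub j i)
    into : ∀ {j u} i → IsEnd j u → Incidence (sub j i) (orig u)

  adjacent⁻ : ∀ {x y} → Adjacent H x y → Incidence x y
  adjacent⁻ a with Anyₚ.tabulate⁻ (Anyₚ.concatMap⁻ _ {xs = allFin m} a)
  ... | j , a' with Anyₚ.tabulate⁻ (Anyₚ.concatMap⁻ _ {xs = allFin d} a')
  ... | i , here (inj₁ (refl , refl))         = out i (inj₁ refl)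
  ... | i , here (inj₂ (refl , refl))         = into i (inj₁ refl)
  ... | i , there (here (inj₁ (refl , refl))) = into i (inj₂ refl)
  ... | i , there (here (inj₂ (refl , refl))) = out i (inj₂ refl)

  orig-neighbour : ∀ {u x y} → Incidence x y → x ≡ orig u → ∃₂ λ j i → IsEnd j u × y ≡ sub j i
  orig-neighbour {u} (out {j} i e) x≡u = j , i , subst (IsEnd j) (orig-injective x≡u) e , refl
  orig-neighbour (into i e) x≡u = ⊥-elim (orig≢sub (sym x≡u))

  sub-neighbour : ∀ {j i x y} → Incidence x y → x ≡ sub j i → ∃ λ u → IsEnd j u × y ≡ orig u
  sub-neighbour (out i e) x≡s = ⊥-elim (orig≢sub x≡s)
  sub-neighbour (into {u = u} i e) x≡s with sub-injective x≡s
  ... | refl , _ = u , e , refl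

  -- Moving v across leaves its subdivision vertices as its only possible company in the new block,
  -- so one of them must lie in that block beforehand, together with the other end of its edge.
  flip-orig⇒cut-edge : ∀ {A v w₀} → InP2 H A → InP2 H (flipV A (orig v)) →
    lookup A (orig w₀) ≡ not (lookup A (orig v)) →
    ∃₂ λ j w → IsEnd j v × IsEnd j w × lookup A (orig w) ≡ not (lookup A (orig v))
  flip-orig⇒cut-edge {A} {v} {w₀} pA pA' w₀∉ =
    let v≢w₀ : orig v ≢ orig w₀
        v≢w₀ e = ≡not⇒≢ w₀∉ (cong (lookup A) (sym e))
        z , a , z∉ = not-isolated H (flipV A (orig v)) (P2⇒sides H (flipV A (orig v)) pA' _) (lookup-flip A (orig v))
                       (trans (lookup-flip-≢ A (v≢w₀ ∘ sym)) w₀∉) v≢w₀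
        j , i , v∈j , z≡s = orig-neighbour (adjacent⁻ a) refl
        s∉ : lookup A (sub j i) ≡ not (lookup A (orig v))
        s∉ = trans (sym (lookup-flip-≢ A {orig v} {sub j i} (orig≢sub ∘ sym))) (trans (cong (lookup (flipV A (orig v))) (sym z≡s)) z∉)
        z' , a' , z'∉ = not-isolated H A (P2⇒sides H A pA _) s∉ w₀∉ (orig≢sub ∘ sym)
        w , w∈j , z'≡w = sub-neighbour (adjacent⁻ a') refl
    in j , w , v∈j , w∈j , trans (cong (lookup A) (sym z'≡w)) z'∉

  -- The only neighbours of a subdivision vertex of `j` are `v` and `w`. After the flip both lie on
  -- the other side, so a subdivision vertex that stays on the old side is isolated in its block.
  -- One such vertex may be the whole block; two would disconnect it.
  flip-orig⇒few-subs : ∀ {A j v w} → IsEnd j v → IsEnd j w → lookup A (orig w) ≡ not (lookup A (orig v)) →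
    InP2 H (flipV A (orig v)) →
    ∀ {i i'} → lookup A (sub j i) ≡ lookup A (orig v) → lookup A (sub j i') ≡ lookup A (orig v) → i ≡ i'
  flip-orig⇒few-subs {A} {j} {v} {w} v∈j w∈j w∉ pA' {i} {i'} s∈ s'∈ with i Finₚ.≟ i'
  ... | yes e = e
  ... | no i≢i' = ⊥-elim absurd
    where
    A' = flipV A (orig v)
    w≢v : w ≢ v
    w≢v e = ≡not⇒≢ w∉ (cong (lookup A ∘ orig) e)
    on-sub : ∀ {k} → lookup A (sub j k) ≡ lookup A (orig v) → lookup A' (sub j k) ≡ lookup A (orig v)
    on-sub = trans (lookup-flip-≢ A (orig≢sub ∘ sym))
    absurd : ⊥
    absurd with not-isolated H (flipV A (orig v)) (P2⇒sides H (flipV A (orig v)) pA' _) (on-sub s∈) (on-sub s'∈) (i≢i' ∘ proj₂ ∘ sub-injective)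
    ... | z , a , z∈ with sub-neighbour (adjacent⁻ a) refl
    ... | u , u∈j , refl with isEnd-cases v∈j w∈j (w≢v ∘ sym) u∈j
    ... | inj₁ refl = ≡not⇒≢ (lookup-flip A (orig v)) z∈
    ... | inj₂ refl = ≡not⇒≢ (trans (lookup-flip-≢ A (w≢v ∘ orig-injective)) w∉) z∈

  -- A subdivision vertex of a cut edge is a leaf of its block, and stays one in the other block.
  module FlipSub (A : VSet (size H)) (pA : InP2 H A) {j : Fin m} (i : Fin d) {v w : Fin n}
    (v∈j : IsEnd j v) (w∈j : IsEnd j w)
    (v∈ : lookup A (orig v) ≡ lookup A (sub j i)) (w∉ : lookup A (orig w) ≡ not (lookup A (sub j i))) where

    s : Fin (size H)
    s = sub j i

    A' : VSet (size H)
    A' = flipV A s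

    v≢w : v ≢ w
    v≢w e = ≡not⇒≢ w∉ (trans (cong (lookup A ∘ orig) (sym e)) v∈)

    -- Walks in the old block may run through `s`, but there they can enter and leave it only by way
    -- of `orig v`. Collapsing `s` onto `orig v` turns them into walks that survive the removal of
    -- `s`.
    contract : Fin (size H) → Fin (size H)
    contract x with x Finₚ.≟ s
    ... | yes _ = orig v
    ... | no  _ = x

    contract-≢ : ∀ {x} → x ≢ s → contract x ≡ x
    contract-≢ {x} x≢s with x Finₚ.≟ s
    ... | yes e = ⊥-elim (x≢s e)
    ... | no  _ = refl

    end-on-side : ∀ {z} → Adjacent H s z → lookup A z ≡ lookup A s → z ≡ orig v
    end-on-side a z∈ with sub-neighbour (adjacent⁻ a) refl
    ... | u , u∈j , refl with isEnd-cases v∈j w∈j v≢w u∈j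
    ... | inj₁ refl = refl
    ... | inj₂ refl = ⊥-elim (≡not⇒≢ w∉ z∈)

    contract-link : ∀ {x y} → Link H A (lookup A s) x y → Walk H A' (lookup A s) (contract x) (contract y)
    contract-link {x} {y} (a , x∈ , y∈) with x Finₚ.≟ s | y Finₚ.≟ s
    ... | yes _ | yes _ = ε
    ... | yes refl | no  _ = subst (Walk H A' _ (orig v)) (sym (end-on-side a y∈)) ε
    ... | no  _ | yes refl = subst (λ z → Walk H A' _ z (orig v)) (sym (end-on-side (Adjacent-sym {H} a) x∈)) ε
    ... | no x≢s | no y≢s = (a , trans (lookup-flip-≢ A x≢s) x∈ , trans (lookup-flip-≢ A y≢s) y∈) ◅ ε

    old-side : SideConnected H A' (lookup A s)
    old-side = hub⇒connected H A' (orig v) λ y y∈ →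
      let y≢s : y ≢ s
          y≢s e = ≡not⇒≢ (lookup-flip A s) (trans (cong (lookup A') (sym e)) y∈)
      in subst₂ (Walk H A' _) (contract-≢ orig≢sub) (contract-≢ y≢s)
           (Star.kleisliStar contract contract-link
             (P2⇒sides H A pA _ (orig v) y v∈ (trans (sym (lookup-flip-≢ A y≢s)) y∈)))

    keep : ∀ {x} → lookup A x ≡ not (lookup A s) → lookup A' x ≡ not (lookup A s)
    keep x∈ = trans (lookup-flip-≢ A λ e → ≡not⇒≢ x∈ (cong (lookup A) e)) x∈

    new-side : SideConnected H A' (not (lookup A s))
    new-side = hub⇒connected H A' (orig w) reach
      where
      reach : ∀ y → lookup A' y ≡ not (lookup A s) → Walk H A' (not (lookup A s)) (orig w) y
      reach y y∈ with y Finₚ.≟ s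
      ... | yes refl = (adjacent⁺ i w∈j , keep w∉ , y∈) ◅ ε
      ... | no  y≢s  = Star.map (λ (a , p , q) → a , keep p , keep q)
              (P2⇒sides H A pA _ (orig w) y w∉ (trans (sym (lookup-flip-≢ A y≢s)) y∈))

    flipped : InP2 H A'
    flipped = sides⇒P2 H A' side
      where
      side : ∀ b → SideConnected H A' b
      side b with b ≟ᵇ lookup A s
      ... | yes refl = old-side
      ... | no  b≢   = subst (SideConnected H A') (sym (≢⇒≡not b≢)) new-side

  -- A cut edge has one end on each side, so on whichever side `sub j i` lies, one end is its
  -- attachment and the other receives it. The two cases exchange `v` and `w`.
  flip-sub : ∀ {A j v w} i → InP2 H A → IsEnd j v → IsEnd j w →
    lookup A (orig w) ≡ not (lookup A (orig v)) → InP2 H (flipV A (sub j i))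
  flip-sub {A} {j} {v} {w} i pA v∈j w∈j w∉ with lookup A (orig v) ≟ᵇ lookup A (sub j i)
  ... | yes e = FlipSub.flipped A pA i v∈j w∈j e (trans w∉ (cong not e))
  ... | no ne = FlipSub.flipped A pA i w∈j v∈j
                  (trans w∉ (trans (cong not (≢⇒≡not ne)) (not-involutive _))) (≢⇒≡not ne)

  -- Traces on the original vertices, and lifts of partitions of G

  trace : VSet (size H) → VSet n
  trace A = Vec.tabulate (lookup A ∘ orig)

  lookup-trace : ∀ A u → lookup (trace A) u ≡ lookup A (orig u)
  lookup-trace A = Vecₚ.lookup∘tabulate (lookup A ∘ orig)

  trace-flip-sub : ∀ A j i → trace (flipV A (sub j i)) ≡ trace A
  trace-flip-sub A j i = Vecₚ.tabulate-cong λ u → lookup-flip-≢ A orig≢sub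

  -- A witness that the fibre over `P` is inhabited. Every subdivision vertex follows the source of
  -- its edge; on a cut edge this is an arbitrary choice, and the vertex becomes a leaf hanging from
  -- the source.
  lift : VSet n → VSet (size H)
  lift P = P Vec.++ Vec.tabulate (lookup P ∘ src ∘ proj₁ ∘ remQuot d)

  lift-orig : ∀ P u → lookup (lift P) (orig u) ≡ lookup P u
  lift-orig P u = Vecₚ.lookup-++ˡ P _ u

  lift-sub : ∀ P j i → lookup (lift P) (sub j i) ≡ lookup P (src j)
  lift-sub P j i = trans (Vecₚ.lookup-++ʳ P _ (combine j i)) (trans (Vecₚ.lookup∘tabulate _ (combine j i))
    (cong (lookup P ∘ src ∘ proj₁) (Finₚ.remQuot-combine j i)))

  trace-lift : ∀ P → trace (lift P) ≡ P
  trace-lift P = trans (Vecₚ.tabulate-cong (lift-orig P)) (Vecₚ.tabulate∘lookup P)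

  module Lift (P : VSet n) (pP : InP2 G P) (i₀ : Fin d) where

    -- An edge inside a block becomes the path of length two through its subdivision vertex number
    -- `i₀`. This vertex copies the source, which lies in the block in whichever order the ends are
    -- stored.
    lift-link : ∀ {b u v} → Link G P b u v → Walk H (lift P) b (orig u) (orig v)
    lift-link {b} {u} {v} (a , u∈ , v∈) = through (Any.index a) (Anyₚ.lookup-index a)
      where
      through : ∀ j → Joins u v (List.lookup (edges G) j) → Walk H (lift P) b (orig u) (orig v)
      through j (inj₁ (p , q)) = (adjacent⁺ i₀ (inj₁ p) , u∈' , s∈) ◅ (Adjacent-sym {H} (adjacent⁺ i₀ (inj₂ q)) , s∈ , v∈') ◅ ε
        where
        u∈' = trans (lift-orig P u) u∈
        v∈' = trans (lift-orig P v) v∈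
        s∈ = trans (lift-sub P j i₀) (trans (cong (lookup P) p) u∈)
      through j (inj₂ (p , q)) = (adjacent⁺ i₀ (inj₂ q) , u∈' , s∈) ◅ (Adjacent-sym {H} (adjacent⁺ i₀ (inj₁ p)) , s∈ , v∈') ◅ ε
        where
        u∈' = trans (lift-orig P u) u∈
        v∈' = trans (lift-orig P v) v∈
        s∈ = trans (lift-sub P j i₀) (trans (cong (lookup P) p) v∈)

    to-orig : ∀ {b} x → lookup (lift P) x ≡ b → ∃ λ u → lookup P u ≡ b × Walk H (lift P) b x (orig u)
    to-orig x x∈ with vertex x
    ... | original u = u , trans (sym (lift-orig P u)) x∈ , ε
    ... | subdivision j i = src j , trans (sym (lift-sub P j i)) x∈ ,
      (Adjacent-sym {H} (adjacent⁺ i (inj₁ refl)) , x∈ , trans (lift-orig P (src j)) (trans (sym (lift-sub P j i)) x∈)) ◅ ε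

    lift-InP2 : InP2 H (lift P)
    lift-InP2 = sides⇒P2 H (lift P) λ b x y x∈ y∈ →
      let u , u∈ , x⇝u = to-orig x x∈
          v , v∈ , y⇝v = to-orig y y∈
      in x⇝u ◅◅ Star.kleisliStar orig lift-link (P2⇒sides G P pP b u v u∈ v∈) ◅◅ walk-sym H (lift P) y⇝v

-- Counting vertex sets

select : {A : Set} → (A → Bool) → List A → List A
select f = filter (λ a → f a ≟ᵇ true)

count : {A : Set} → (A → Bool) → List A → ℕ
count f xs = length (select f xs)

card : ∀ {N} → (VSet N → Bool) → ℕ
card {N} f = count f (allSubsets N)

module _ {A : Set} where

  count-∷ : ∀ (f : A → Bool) x xs → count f (x ∷ xs) ≡ (if f x then 1 else 0) + count f xs
  count-∷ f x xs with f x
  ... | true  = refl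
  ... | false = refl

  count-cong : ∀ {f g : A → Bool} → (∀ a → f a ≡ g a) → ∀ xs → count f xs ≡ count g xs
  count-cong h []       = refl
  count-cong {f} {g} h (x ∷ xs) rewrite count-∷ f x xs | count-∷ g x xs | h x = cong (_ +_) (count-cong h xs)

  count-mono : ∀ {f g : A → Bool} → (∀ a → f a ≡ true → g a ≡ true) → ∀ xs → count f xs ≤ count g xs
  count-mono h [] = z≤n
  count-mono {f} {g} h (x ∷ xs) with f x in ef | g x in eg
  ... | true  | true  = s≤s (count-mono h xs)
  ... | true  | false = contradiction (trans (sym (h x ef)) eg) λ ()
  ... | false | true  = ℕₚ.m≤n⇒m≤1+n (count-mono h xs)
  ... | false | false = count-mono h xs

  count-false : ∀ {f : A → Bool} → (∀ a → f a ≡ false) → ∀ xs → count f xs ≡ 0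
  count-false h [] = refl
  count-false {f} h (x ∷ xs) rewrite h x = count-false h xs

  count-split : ∀ (f g : A → Bool) xs → count f xs ≡ count (λ a → f a ∧ g a) xs + count (λ a → f a ∧ not (g a)) xs
  count-split f g [] = refl
  count-split f g (x ∷ xs) with f x | g x
  ... | true  | true  = cong suc (count-split f g xs)
  ... | true  | false = trans (cong suc (count-split f g xs)) (sym (ℕₚ.+-suc _ _))
  ... | false | _     = count-split f g xs

  count-++ : ∀ (f : A → Bool) xs ys → count f (xs ++ ys) ≡ count f xs + count f ys
  count-++ f xs ys = trans (cong length (Listₚ.filter-++ (λ a → f a ≟ᵇ true) xs ys)) (Listₚ.length-++ (select f xs))

  count-map : ∀ {B : Set} (f : A → Bool) (g : B → A) xs → count f (map g xs) ≡ count (f ∘ g) xs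
  count-map f g [] = refl
  count-map f g (x ∷ xs) with f (g x)
  ... | true  = cong suc (count-map f g xs)
  ... | false = count-map f g xs

  count-concatMap : ∀ {B : Set} (f : A → Bool) (g : B → List A) xs →
    count f (concatMap g xs) ≡ sum (map (count f ∘ g) xs)
  count-concatMap f g [] = refl
  count-concatMap f g (x ∷ xs) = trans (count-++ f (g x) (concatMap g xs)) (cong (_ +_) (count-concatMap f g xs))

  count-↭ : ∀ (f : A → Bool) {xs ys} → xs ↭ ys → count f xs ≡ count f ys
  count-↭ f p = ↭ₚ.↭-length (↭ₚ.filter-↭ (λ a → f a ≟ᵇ true) p)

  count-select : ∀ (f g : A → Bool) xs → count f (select g xs) ≡ count (λ a → g a ∧ f a) xs
  count-select f g [] = refl
  count-select f g (x ∷ xs) with g x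
  ... | false = count-select f g xs
  ... | true with f x
  ...   | true  = cong suc (count-select f g xs)
  ...   | false = count-select f g xs

  ∈-select⁺ : ∀ (f : A → Bool) {x xs} → x ∈ xs → f x ≡ true → x ∈ select f xs
  ∈-select⁺ f = Memₚ.∈-filter⁺ (λ a → f a ≟ᵇ true)

  ∈-select⁻ : ∀ (f : A → Bool) {x} xs → x ∈ select f xs → x ∈ xs × f x ≡ true
  ∈-select⁻ f xs = Memₚ.∈-filter⁻ (λ a → f a ≟ᵇ true) {xs = xs}

  -- `conductance` minimises over sublists of `P2 H` in their given order. This makes a set of
  -- states described by a predicate one of the candidates.
  select∈sublists : ∀ {f g : A → Bool} → (∀ a → f a ≡ true → g a ≡ true) → ∀ xs → select f xs ∈ sublists (select g xs)
  select∈sublists h [] = here refl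
  select∈sublists {f} {g} h (x ∷ xs) with f x in ef | g x in eg
  ... | true  | true  = Memₚ.∈-++⁺ˡ (Memₚ.∈-map⁺ (x ∷_) (select∈sublists h xs))
  ... | true  | false = contradiction (trans (sym (h x ef)) eg) λ ()
  ... | false | true  = Memₚ.∈-++⁺ʳ (map (x ∷_) (sublists (select g xs))) (select∈sublists h xs)
  ... | false | false = select∈sublists h xs

sum-count-swap : ∀ {A B : Set} (f : A → B → Bool) xs ys →
  sum (map (λ a → count (f a) ys) xs) ≡ sum (map (λ b → count (λ a → f a b) xs) ys)
sum-count-swap f [] ys = sym (zeros ys)
  where
  zeros : ∀ {B : Set} (ys : List B) → sum (map (λ _ → 0) ys) ≡ 0
  zeros []       = refl
  zeros (_ ∷ ys) = zeros ys
sum-count-swap {A} {B} f (x ∷ xs) ys = trans (cong (count (f x) ys +_) (sum-count-swap f xs ys)) (sym (split ys))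
  where
  split : ∀ ys → sum (map (λ b → count (λ a → f a b) (x ∷ xs)) ys) ≡
    count (f x) ys + sum (map (λ b → count (λ a → f a b) xs) ys)
  split [] = refl
  split (y ∷ ys) rewrite split ys with f x y
  ... | true  = cong suc (solve 3 (λ a b c → a :+ (b :+ c) := b :+ (a :+ c)) refl
      (count (λ a → f a y) xs) (count (f x) ys) (sum (map (λ b → count (λ a → f a b) xs) ys)))
    where open +-*-Solver
  ... | false = solve 3 (λ a b c → a :+ (b :+ c) := b :+ (a :+ c)) refl
      (count (λ a → f a y) xs) (count (f x) ys) (sum (map (λ b → count (λ a → f a b) xs) ys))
    where open +-*-Solver

sum-map-≤ : ∀ {A : Set} (f : A → ℕ) k c → (∀ a → f a * k ≤ c) → ∀ xs → sum (map f xs) * k ≤ length xs * c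
sum-map-≤ f k c h [] = z≤n
sum-map-≤ f k c h (x ∷ xs) rewrite ℕₚ.*-distribʳ-+ k (f x) (sum (map f xs)) =
  ℕₚ.+-mono-≤ (h x) (sum-map-≤ f k c h xs)

∈-allSubsets : ∀ {N} (A : VSet N) → A ∈ allSubsets N
∈-allSubsets [] = here refl
∈-allSubsets (true ∷ A)  = Memₚ.∈-++⁺ˡ (Memₚ.∈-map⁺ (true ∷_) (∈-allSubsets A))
∈-allSubsets (false ∷ A) = Memₚ.∈-++⁺ʳ (map (true ∷_) (allSubsets _)) (Memₚ.∈-map⁺ (false ∷_) (∈-allSubsets A))

length-allSubsets : ∀ N → length (allSubsets N) ≡ 2 ^ N
length-allSubsets zero = refl
length-allSubsets (suc N) = trans (Listₚ.length-++ (map (true ∷_) (allSubsets N))) (trans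
  (cong₂ _+_ (Listₚ.length-map (true ∷_) (allSubsets N)) (Listₚ.length-map (false ∷_) (allSubsets N)))
  (trans (cong (λ k → k + k) (length-allSubsets N)) (cong (2 ^ N +_) (sym (ℕₚ.+-identityʳ _)))))

-- At the head, the flip exchanges the two halves of the list; further on, it permutes each half by
-- induction.
allSubsets-flip : ∀ {N} (x : Fin N) → map (λ A → flipV A x) (allSubsets N) ↭ allSubsets N
allSubsets-flip {suc N} zero = ↭-trans (↭-reflexive (trans
    (Listₚ.map-++ (λ A → flipV A zero) (map (true ∷_) (allSubsets N)) (map (false ∷_) (allSubsets N)))
    (cong₂ _++_ (sym (Listₚ.map-∘ (allSubsets N))) (sym (Listₚ.map-∘ (allSubsets N))))))
  (↭ₚ.++-comm (map (false ∷_) (allSubsets N)) (map (true ∷_) (allSubsets N)))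
allSubsets-flip {suc N} (suc x) = ↭-trans (↭-reflexive
    (Listₚ.map-++ (λ A → flipV A (suc x)) (map (true ∷_) (allSubsets N)) (map (false ∷_) (allSubsets N))))
  (↭ₚ.++⁺ (half true) (half false))
  where
  half : ∀ b → map (λ A → flipV A (suc x)) (map (b ∷_) (allSubsets N)) ↭ map (b ∷_) (allSubsets N)
  half b = ↭-trans (↭-reflexive (trans (sym (Listₚ.map-∘ (allSubsets N))) (Listₚ.map-∘ (allSubsets N))))
    (↭ₚ.map⁺ (b ∷_) (allSubsets-flip x))

card-flip : ∀ {N} (f : VSet N → Bool) x → card (λ A → f (flipV A x)) ≡ card f
card-flip {N} f x = trans (sym (count-map f (λ A → flipV A x) (allSubsets N))) (count-↭ f (allSubsets-flip x))

-- Halving a family of sets along free coordinates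

agrees : Bool → Bool → Bool
agrees true  x = x
agrees false x = not x

agrees-not : ∀ b x → agrees b (not x) ≡ not (agrees b x)
agrees-not true  x = refl
agrees-not false x = refl

agrees⁻ : ∀ b {x} → agrees b x ≡ true → x ≡ b
agrees⁻ true  e = e
agrees⁻ false e = not-true⁻ e

Invariant : ∀ {N} → (VSet N → Bool) → Fin N → Set
Invariant h x = ∀ A → h (flipV A x) ≡ h A

-- Flipping `s` is a bijection between the two classes, since it reverses the side of `s` and stays
-- within `h`.
card-halves : ∀ {N} {h : VSet N → Bool} {s} b → Invariant h s →
  card (λ A → h A ∧ not (agrees b (lookup A s))) ≡ card (λ A → h A ∧ agrees b (lookup A s))
card-halves {N} {h} {s} b inv = trans
  (count-cong (λ A → sym (cong₂ _∧_ (inv A) (trans (cong (agrees b) (lookup-flip A s)) (agrees-not b _)))) (allSubsets N))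
  (card-flip (λ A → h A ∧ agrees b (lookup A s)) s)

card-halve : ∀ {N} {h : VSet N → Bool} {s} b → Invariant h s →
  2 * card (λ A → h A ∧ not (agrees b (lookup A s))) ≡ card h
card-halve {N} {h} {s} b inv = trans (cong (off +_) (ℕₚ.+-identityʳ off)) (trans
  (cong (_+ off) (card-halves b inv))
  (sym (count-split h (λ A → agrees b (lookup A s)) (allSubsets N))))
  where
  off = card (λ A → h A ∧ not (agrees b (lookup A s)))

noneOn atMostOneOn : ∀ {N} → Bool → List (Fin N) → VSet N → Bool
noneOn b []      A = true
noneOn b (s ∷ L) A = noneOn b L A ∧ not (agrees b (lookup A s))
atMostOneOn b []      A = true
atMostOneOn b (s ∷ L) A = if agrees b (lookup A s) then noneOn b L A else atMostOneOn b L A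

noneOn-invariant : ∀ {N} b {L} {s : Fin N} → All (s ≢_) L → Invariant (noneOn b L) s
noneOn-invariant b [] A = refl
noneOn-invariant b (s≢ ∷ ss) A =
  cong₂ (λ p q → p ∧ not (agrees b q)) (noneOn-invariant b ss A) (lookup-flip-≢ A (s≢ ∘ sym))

atMostOneOn-invariant : ∀ {N} b {L} {s : Fin N} → All (s ≢_) L → Invariant (atMostOneOn b L) s
atMostOneOn-invariant b [] A = refl
atMostOneOn-invariant b {s' ∷ L} {s} (s≢ ∷ ss) A
  rewrite lookup-flip-≢ A {s} {s'} (s≢ ∘ sym) | noneOn-invariant b ss A | atMostOneOn-invariant b ss A = refl

noneOn⁺ : ∀ {N} b {L} {A : VSet N} → (∀ {s} → s ∈ L → lookup A s ≢ b) → noneOn b L A ≡ true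
noneOn⁺ b {[]} h = refl
noneOn⁺ b {s ∷ L} {A} h with agrees b (lookup A s) in e
... | true  = ⊥-elim (h (here refl) (agrees⁻ b e))
... | false = cong (_∧ true) (noneOn⁺ b {L} {A} (h ∘ there))

atMostOneOn⁺ : ∀ {N} b {L} {A : VSet N} → Unique L →
  (∀ {s t} → s ∈ L → t ∈ L → lookup A s ≡ b → lookup A t ≡ b → s ≡ t) → atMostOneOn b L A ≡ true
atMostOneOn⁺ b [] h = refl
atMostOneOn⁺ b {s ∷ L} {A} (s∉L ∷ uniq) h with agrees b (lookup A s) in e
... | true  = noneOn⁺ b λ t∈L t≡b → All.lookup s∉L t∈L (h (here refl) (there t∈L) (agrees⁻ b e) t≡b)
... | false = atMostOneOn⁺ b uniq λ p q → h (there p) (there q)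

module _ {N} (u : VSet N → Bool) (b : Bool) where

  card-noneOn : ∀ {L} → Unique L → (∀ {s} → s ∈ L → Invariant u s) →
    2 ^ length L * card (λ A → u A ∧ noneOn b L A) ≡ card u
  card-noneOn [] _ = trans (ℕₚ.+-identityʳ _) (count-cong (λ A → ∧-identityʳ (u A)) (allSubsets N))
  card-noneOn {s ∷ L} (s∉L ∷ uniq) inv = begin
    2 * k * card (λ A → u A ∧ noneOn b (s ∷ L) A)
      ≡⟨ cong (2 * k *_) (count-cong (λ A → sym (∧-assoc (u A) _ _)) (allSubsets N)) ⟩
    2 * k * off
      ≡⟨ solve 2 (λ k c → con 2 :* k :* c := k :* (con 2 :* c)) refl k off ⟩
    k * (2 * off)
      ≡⟨ cong (k *_) (card-halve b λ A → cong₂ _∧_ (inv (here refl) A) (noneOn-invariant b s∉L A)) ⟩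
    k * card (λ A → u A ∧ noneOn b L A)
      ≡⟨ card-noneOn uniq (inv ∘ there) ⟩
    card u ∎
    where
    open ≡-Reasoning
    open +-*-Solver
    k = 2 ^ length L
    off = card (λ A → (u A ∧ noneOn b L A) ∧ not (agrees b (lookup A s)))

  -- Of the `2 ^ length L` placements of `L`, all equally frequent in `u`, the empty one and the
  -- `length L` singletons qualify. The induction splits on the first element: if it is on side `b`,
  -- none of the rest may be, which contributes 1; otherwise at most one of the rest may be, which
  -- contributes `suc (length L)`.
  card-atMostOneOn : ∀ {L} → Unique L → (∀ {s} → s ∈ L → Invariant u s) →
    2 ^ length L * card (λ A → u A ∧ atMostOneOn b L A) ≡ suc (length L) * card u
  card-atMostOneOn [] inv = trans (card-noneOn [] inv) (sym (ℕₚ.+-identityʳ _))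
  card-atMostOneOn {s ∷ L} (s∉L ∷ uniq) inv = begin
    2 * k * card (λ A → u A ∧ atMostOneOn b (s ∷ L) A)
      ≡⟨ cong (2 * k *_) (trans (count-split _ onSide (allSubsets N)) (cong₂ _+_
           -- The half with `s` on side `b` is replaced by its mirror image under the flip of `s`,
           -- because `card-halve` speaks of the off half; it then applies to both terms.
           (trans (count-cong on (allSubsets N))
             (sym (card-halves b λ A → cong₂ _∧_ (inv (here refl) A) (noneOn-invariant b s∉L A))))
           (count-cong off (allSubsets N)))) ⟩
    2 * k * (c₁ + c₂)
      ≡⟨ solve 3 (λ k a b → con 2 :* k :* (a :+ b) := k :* (con 2 :* a) :+ k :* (con 2 :* b)) refl k c₁ c₂ ⟩
    k * (2 * c₁) + k * (2 * c₂)
      ≡⟨ cong₂ (λ p q → k * p + k * q)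
           (card-halve b λ A → cong₂ _∧_ (inv (here refl) A) (noneOn-invariant b s∉L A))
           (card-halve b λ A → cong₂ _∧_ (inv (here refl) A) (atMostOneOn-invariant b s∉L A)) ⟩
    k * card (λ A → u A ∧ noneOn b L A) + k * card (λ A → u A ∧ atMostOneOn b L A)
      ≡⟨ cong₂ _+_ (card-noneOn uniq (inv ∘ there)) (card-atMostOneOn uniq (inv ∘ there)) ⟩
    suc (suc (length L)) * card u ∎
    where
    open ≡-Reasoning
    open +-*-Solver
    k = 2 ^ length L
    onSide : VSet N → Bool
    onSide A = agrees b (lookup A s)
    c₁ c₂ : ℕ
    c₁ = card (λ A → (u A ∧ noneOn b L A) ∧ not (onSide A))
    c₂ = card (λ A → (u A ∧ atMostOneOn b L A) ∧ not (onSide A))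
    on : ∀ A → (u A ∧ atMostOneOn b (s ∷ L) A) ∧ onSide A ≡ (u A ∧ noneOn b L A) ∧ onSide A
    on A with u A | agrees b (lookup A s)
    ... | true  | true  = refl
    ... | true  | false = trans (∧-zeroʳ (atMostOneOn b L A)) (sym (∧-zeroʳ (noneOn b L A)))
    ... | false | _     = refl
    off : ∀ A → (u A ∧ atMostOneOn b (s ∷ L) A) ∧ not (onSide A) ≡ (u A ∧ atMostOneOn b L A) ∧ not (onSide A)
    off A with u A | agrees b (lookup A s)
    ... | true  | true  = trans (∧-zeroʳ (noneOn b L A)) (sym (∧-zeroʳ (atMostOneOn b L A)))
    ... | true  | false = refl
    ... | false | _     = refl

-- Bottleneck ratio of a set of states

crossing : ∀ H → (VSet (size H) → Bool) → Fin (size H) → VSet (size H) → Bool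
crossing H u x A = u A ∧ (isP2 H (flipV A x) ∧ not (u (flipV A x)))

crossings : ∀ H → (VSet (size H) → Bool) → ℕ
crossings H u = sum (map (λ x → card (crossing H u x)) (allFin (size H)))

≟ⱽ⁻ : ∀ {N} {A B : VSet N} → (A ≟ⱽ B) ≡ true → A ≡ B
≟ⱽ⁻ {A = A} {B} = isYes-true⁻ (Vecₚ.≡-dec _≟ᵇ_ A B)

≟ⱽ⁺ : ∀ {N} {A B : VSet N} → A ≡ B → (A ≟ⱽ B) ≡ true
≟ⱽ⁺ {A = A} {B} = isYes-true⁺ (Vecₚ.≡-dec _≟ᵇ_ A B)

true-ext : ∀ {x y} → (x ≡ true → y ≡ true) → (y ≡ true → x ≡ true) → x ≡ y
true-ext {true}  {y}     f g = sym (f refl)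
true-ext {false} {true}  f g = g refl
true-ext {false} {false} f g = refl

memᵇ-select : ∀ {N} (u : VSet N → Bool) A → memᵇ A (select u (allSubsets N)) ≡ u A
memᵇ-select {N} u A = true-ext
  (λ e → member (Anyₚ.any⁻ (A ≟ⱽ_) _ (from T-≡ e)))
  (λ e → to T-≡ (Anyₚ.any⁺ (A ≟ⱽ_) (Any.map (λ eq → from T-≡ (≟ⱽ⁺ eq)) (∈-select⁺ u (∈-allSubsets A) e))))
  where
  member : Any (T ∘ (A ≟ⱽ_)) (select u (allSubsets N)) → u A ≡ true
  member a = proj₂ (∈-select⁻ u (allSubsets N) (Any.map (λ t → ≟ⱽ⁻ (to T-≡ t)) a))

-- Double counting: `boundary` goes through the states first, `crossings` through the flipped vertex
-- first. The second order suits both the bound for each vertex and the estimate of one step of the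
-- walk.
boundary-select : ∀ H u → boundary H (select u (allSubsets (size H))) ≡ crossings H u
boundary-select H u = begin
  boundary H U
    ≡⟨ count-concatMap id (λ A → map (λ x → leaves A x ) (allFin N)) U ⟩
  sum (map (λ A → count id (map (leaves A) (allFin N))) U)
    ≡⟨ cong sum (Listₚ.map-cong (λ A → trans (count-map id (leaves A) (allFin N)) (count-cong (leaves≡ A) (allFin N))) U) ⟩
  sum (map (λ A → count (λ x → isP2 H (flipV A x) ∧ not (u (flipV A x))) (allFin N)) U)
    ≡⟨ sum-count-swap (λ A x → isP2 H (flipV A x) ∧ not (u (flipV A x))) U (allFin N) ⟩
  sum (map (λ x → count (λ A → isP2 H (flipV A x) ∧ not (u (flipV A x))) U) (allFin N))
    ≡⟨ cong sum (Listₚ.map-cong (λ x → count-select _ u (allSubsets N)) (allFin N)) ⟩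
  crossings H u ∎
  where
  open ≡-Reasoning
  N = size H
  U = select u (allSubsets N)
  leaves : VSet N → Fin N → Bool
  leaves A x = isP2 H (flipV A x) ∧ not (memᵇ (flipV A x) U)
  leaves≡ : ∀ A x → leaves A x ≡ (isP2 H (flipV A x) ∧ not (u (flipV A x)))
  leaves≡ A x = cong (λ b → isP2 H (flipV A x) ∧ not b) (memᵇ-select u (flipV A x))

-- Flips that leave the fibre over one partition

module Fibre (G : Graph) (d : ℕ) (P : VSet (size G)) (pP : InP2 G P) (P-nonempty : BlocksNonempty G P) where

  open Star-of G d

  fibre : VSet (size H) → Bool
  fibre A = isP2 H A ∧ (trace A ≟ⱽ P)

  fibre⁻ : ∀ {A} → fibre A ≡ true → InP2 H A × trace A ≡ P
  fibre⁻ e = proj₁ (∧-true⁻ e) , ≟ⱽ⁻ (proj₂ (∧-true⁻ e))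

  fibre⁺ : ∀ {A} → InP2 H A → trace A ≡ P → fibre A ≡ true
  fibre⁺ p t = cong₂ _∧_ p (≟ⱽ⁺ t)

  CutEdgeAt : Fin n → Fin m → Fin n → Set
  CutEdgeAt v j w = IsEnd j v × IsEnd j w × lookup P w ≡ not (lookup P v)

  cutEdgeAt? : ∀ v → Dec (∃₂ (CutEdgeAt v))
  cutEdgeAt? v = Finₚ.any? λ j → Finₚ.any? λ w →
    isEnd? j v ×-dec isEnd? j w ×-dec lookup P w ≟ᵇ not (lookup P v)
    where
    isEnd? : ∀ j u → Dec (IsEnd j u)
    isEnd? j u = src j Finₚ.≟ u ⊎-dec tgt j Finₚ.≟ u

  -- Nonempty blocks enter here. They give an original vertex already on the side to which `v`
  -- moves, so `v` is not alone there and must have a neighbour.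
  opposite : ∀ v → ∃ λ w → lookup P w ≡ not (lookup P v)
  opposite v with lookup P v
  ... | true  = let w , e = anyFin⁻ _ (proj₂ P-nonempty) in w , not-true⁻ e
  ... | false = anyFin⁻ _ (proj₁ P-nonempty)

  lookup-fibre : ∀ A → trace A ≡ P → ∀ u → lookup A (orig u) ≡ lookup P u
  lookup-fibre A refl u = sym (lookup-trace A u)

  opposite-fibre : ∀ A {v w} → trace A ≡ P → lookup P w ≡ not (lookup P v) → lookup A (orig w) ≡ not (lookup A (orig v))
  opposite-fibre A {v} {w} t w∉ = trans (lookup-fibre A t w) (trans w∉ (cong not (sym (lookup-fibre A t v))))

  -- The flip leaves the trace alone, so the edge is still cut afterwards and the same implication
  -- applies to the flipped set. As the flip is an involution, this yields the converse.
  fibre-invariant : ∀ {v j w} i → CutEdgeAt v j w → Invariant fibre (sub j i)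
  fibre-invariant {v} {j} {w} i (v∈j , w∈j , w∉) A = true-ext backward (forward A)
    where
    forward : ∀ A → fibre A ≡ true → fibre (flipV A (sub j i)) ≡ true
    forward A e = let p , t = fibre⁻ {A} e in
      fibre⁺ (flip-sub {A} i p v∈j w∈j (opposite-fibre A t w∉)) (trans (trace-flip-sub A j i) t)
    flip-flip : flipV (flipV A (sub j i)) (sub j i) ≡ A
    flip-flip = trans (Vecₚ.updateAt-updateAt (sub j i) A) (Vecₚ.updateAt-id-local (sub j i) A (not-involutive _))
    backward : fibre (flipV A (sub j i)) ≡ true → fibre A ≡ true
    backward e = trans (cong fibre (sym flip-flip)) (forward (flipV A (sub j i)) e)

  crossing⁻ : ∀ {x A} → crossing H fibre x A ≡ true →
    (InP2 H A × trace A ≡ P) × InP2 H (flipV A x) × trace (flipV A x) ≢ P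
  crossing⁻ {x} {A} e = fibre⁻ {A} f , p , λ t → contradiction (trans (sym (fibre⁺ {flipV A x} p t)) (not-true⁻ ¬f)) λ ()
    where
    f = proj₁ (∧-true⁻ {fibre A} e)
    p = proj₁ (∧-true⁻ {isP2 H (flipV A x)} (proj₂ (∧-true⁻ {fibre A} e)))
    ¬f : not (fibre (flipV A x)) ≡ true
    ¬f = proj₂ (∧-true⁻ {isP2 H (flipV A x)} (proj₂ (∧-true⁻ {fibre A} e)))

  subs : Fin m → List (Fin (size H))
  subs j = List.tabulate (sub j)

  subs-unique : ∀ j → Unique (subs j)
  subs-unique j = Uniqueₚ.tabulate⁺ λ {i} {i'} → proj₂ ∘ sub-injective {j} {j} {i} {i'}

  crossing⇒few : ∀ {v j w} A → CutEdgeAt v j w → crossing H fibre (orig v) A ≡ true →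
    fibre A ∧ atMostOneOn (lookup P v) (subs j) A ≡ true
  crossing⇒few {v} {j} {w} A (v∈j , w∈j , w∉) e =
    cong₂ _∧_ (fibre⁺ {A} p t) (atMostOneOn⁺ (lookup P v) (subs-unique j) λ s∈L s'∈L →
      few (Memₚ.∈-tabulate⁻ s∈L) (Memₚ.∈-tabulate⁻ s'∈L))
    where
    p = proj₁ (proj₁ (crossing⁻ {orig v} {A} e))
    t = proj₂ (proj₁ (crossing⁻ {orig v} {A} e))
    p' = proj₁ (proj₂ (crossing⁻ {orig v} {A} e))
    few : ∀ {s s'} → (∃ λ i → s ≡ sub j i) → (∃ λ i → s' ≡ sub j i) →
      lookup A s ≡ lookup P v → lookup A s' ≡ lookup P v → s ≡ s'
    few (i , refl) (i' , refl) es es' = cong (sub j) (flip-orig⇒few-subs {A} v∈j w∈j (opposite-fibre A t w∉) p'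
      (trans es (sym (lookup-fibre A t v))) (trans es' (sym (lookup-fibre A t v))))

  crossing⇒cut-edge : ∀ v A → crossing H fibre (orig v) A ≡ true → ∃₂ (CutEdgeAt v)
  crossing⇒cut-edge v A e =
    let (p , t) , p' , _ = crossing⁻ {orig v} {A} e
        w₀ , w₀∉ = opposite v
        j , w , v∈j , w∈j , w∉ = flip-orig⇒cut-edge {A} {v} {w₀} p p' (opposite-fibre A t w₀∉)
    in j , w , v∈j , w∈j , trans (sym (lookup-fibre A t w)) (trans w∉ (cong not (lookup-fibre A t v)))

  crossing-count-0 : ∀ x → (∀ A → ¬ crossing H fibre x A ≡ true) → card (crossing H fibre x) * 2 ^ d ≤ suc d * card fibre
  crossing-count-0 x none = subst (λ k → k * 2 ^ d ≤ suc d * card fibre)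
    (sym (count-false (λ A → ¬-not (none A)) (allSubsets (size H)))) z≤n

  crossing-count-cut : ∀ {v j w} → CutEdgeAt v j w → card (crossing H fibre (orig v)) * 2 ^ d ≤ suc d * card fibre
  crossing-count-cut {v} {j} {w} cut = begin
    card (crossing H fibre (orig v)) * 2 ^ d
      ≤⟨ ℕₚ.*-monoˡ-≤ (2 ^ d) (count-mono (λ A → crossing⇒few A cut) (allSubsets (size H))) ⟩
    card few * 2 ^ d
      ≡⟨ ℕₚ.*-comm (card few) (2 ^ d) ⟩
    2 ^ d * card few
      ≡⟨ subst (λ k → 2 ^ k * card few ≡ suc k * card fibre) (Listₚ.length-tabulate (sub j))
           (card-atMostOneOn fibre b (subs-unique j) (invariant ∘ Memₚ.∈-tabulate⁻)) ⟩
    suc d * card fibre ∎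
    where
    open ℕₚ.≤-Reasoning
    b = lookup P v
    few : VSet (size H) → Bool
    few A = fibre A ∧ atMostOneOn b (subs j) A
    invariant : ∀ {s} → (∃ λ i → s ≡ sub j i) → Invariant fibre s
    invariant (i , refl) = fibre-invariant i cut

  -- If `v` lies on several cut edges, any one of them suffices for the bound. In the remaining
  -- cases nothing crosses: a vertex on no cut edge cannot be flipped within `P2 H`, and a
  -- subdivision vertex does not affect the trace.
  crossing-count : ∀ x → card (crossing H fibre x) * 2 ^ d ≤ suc d * card fibre
  crossing-count x = by-vertex (vertex x)
    where
    by-cut-edge : ∀ v → Dec (∃₂ (CutEdgeAt v)) → card (crossing H fibre (orig v)) * 2 ^ d ≤ suc d * card fibre
    by-cut-edge v (yes (j , w , cut)) = crossing-count-cut cut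
    by-cut-edge v (no none)           = crossing-count-0 (orig v) λ A e → none (crossing⇒cut-edge v A e)
    by-vertex : ∀ {x} → Vertex x → card (crossing H fibre x) * 2 ^ d ≤ suc d * card fibre
    by-vertex (original v)      = by-cut-edge v (cutEdgeAt? v)
    by-vertex (subdivision j i) = crossing-count-0 (sub j i) λ A e →
      let (_ , t) , _ , ¬t = crossing⁻ {sub j i} {A} e in ¬t (trans (trace-flip-sub A j i) t)

  crossings-bound : crossings H fibre * 2 ^ d ≤ size H * (suc d * card fibre)
  crossings-bound = subst (λ k → crossings H fibre * 2 ^ d ≤ k * (suc d * card fibre)) (Listₚ.length-tabulate {n = size H} id)
    (sum-map-≤ (λ x → card (crossing H fibre x)) (2 ^ d) (suc d * card fibre) crossing-count (allFin (size H)))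

  fibre-nonempty : Fin d → 1 ≤ card fibre
  fibre-nonempty i = Memₚ.∈-length (∈-select⁺ fibre (∈-allSubsets (lift P)) (fibre⁺ {lift P} (Lift.lift-InP2 P pP i) (trace-lift P)))

-- Rational numbers with natural numerator and denominator

-- The quotient `+ k / 1` is normalised by a gcd, which does not compute for a variable `k`. The
-- unnormalised fraction does, so identities are checked there and transported back.
toℚᵘ-fromℕ : ∀ k → toℚᵘ (fromℕ k) ℚᵘ.≃ ℚᵘ.mkℚᵘ (pos k) 0
toℚᵘ-fromℕ k = ℚₚ.toℚᵘ-fromℚᵘ (ℚᵘ.mkℚᵘ (pos k) 0)

fromℕ-+ : ∀ a b → fromℕ (a + b) ≡ fromℕ a +ℚ fromℕ b
fromℕ-+ a b = ℚₚ.toℚᵘ-injective (ℚᵘₚ.≃-trans (toℚᵘ-fromℕ (a + b)) (ℚᵘₚ.≃-trans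
  (ℚᵘ.*≡* (cong (ℤ._* pos 1) (sym (cong₂ ℤ._+_ (ℤₚ.*-identityʳ (pos a)) (ℤₚ.*-identityʳ (pos b))))))
  (ℚᵘₚ.≃-sym (ℚᵘₚ.≃-trans (ℚₚ.toℚᵘ-homo-+ (fromℕ a) (fromℕ b)) (ℚᵘₚ.+-cong (toℚᵘ-fromℕ a) (toℚᵘ-fromℕ b))))))

fromℕ-* : ∀ a b → fromℕ (a * b) ≡ fromℕ a *ℚ fromℕ b
fromℕ-* a b = ℚₚ.toℚᵘ-injective (ℚᵘₚ.≃-trans (toℚᵘ-fromℕ (a * b)) (ℚᵘₚ.≃-trans
  (ℚᵘ.*≡* (cong (ℤ._* pos 1) (ℤₚ.pos-* a b)))
  (ℚᵘₚ.≃-sym (ℚᵘₚ.≃-trans (ℚₚ.toℚᵘ-homo-* (fromℕ a) (fromℕ b)) (ℚᵘₚ.*-cong (toℚᵘ-fromℕ a) (toℚᵘ-fromℕ b))))))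

fromℕ-mono : ∀ {a b} → a ≤ b → fromℕ a ≤ℚ fromℕ b
fromℕ-mono {a} {b} a≤b = ℚₚ.toℚᵘ-cancel-≤ (ℚᵘₚ.≤-trans (ℚᵘₚ.≤-reflexive (toℚᵘ-fromℕ a)) (ℚᵘₚ.≤-trans
  (ℚᵘ.*≤* (ℤₚ.*-monoʳ-≤-nonNeg (pos 1) (ℤ.+≤+ a≤b)))
  (ℚᵘₚ.≤-reflexive (ℚᵘₚ.≃-sym (toℚᵘ-fromℕ b)))))

fromℕ-cancel-≤ : ∀ {a b} → fromℕ a ≤ℚ fromℕ b → a ≤ b
fromℕ-cancel-≤ {a} {b} h = ℤₚ.drop‿+≤+ (subst₂ ℤ._≤_ (ℤₚ.*-identityʳ (pos a)) (ℤₚ.*-identityʳ (pos b))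
  (ℚᵘₚ.drop-*≤* (ℚᵘₚ.≤-trans (ℚᵘₚ.≤-reflexive (ℚᵘₚ.≃-sym (toℚᵘ-fromℕ a))) (ℚᵘₚ.≤-trans
    (ℚₚ.toℚᵘ-mono-≤ h) (ℚᵘₚ.≤-reflexive (toℚᵘ-fromℕ b))))))

recip-inverse : ∀ {k} → 1 ≤ k → recip k *ℚ fromℕ k ≡ 1ℚ
recip-inverse {suc k} _ = ℚₚ.toℚᵘ-injective (ℚᵘₚ.≃-trans (ℚₚ.toℚᵘ-homo-* (recip (suc k)) (fromℕ (suc k))) (ℚᵘₚ.≃-trans
  (ℚᵘₚ.*-cong (ℚₚ.toℚᵘ-fromℚᵘ (ℚᵘ.mkℚᵘ (pos 1) k)) (toℚᵘ-fromℕ (suc k)))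
  (ℚᵘ.*≡* (cong (λ x → pos (suc x)) (trans (ℕₚ.*-identityʳ (k + 0)) (trans (ℕₚ.+-identityʳ k)
    (sym (trans (ℕₚ.+-identityʳ (k * 1)) (ℕₚ.*-identityʳ k)))))))))

0≤fromℕ : ∀ k → 0ℚ ≤ℚ fromℕ k
0≤fromℕ k = fromℕ-mono (z≤n {k})

0≤recip : ∀ k → 0ℚ ≤ℚ recip k
0≤recip zero    = ℚₚ.≤-refl
0≤recip (suc k) = ℚₚ.toℚᵘ-cancel-≤ (ℚᵘₚ.≤-trans (ℚᵘ.*≤* (ℤ.+≤+ z≤n))
  (ℚᵘₚ.≤-reflexive (ℚᵘₚ.≃-sym (ℚₚ.toℚᵘ-fromℚᵘ (ℚᵘ.mkℚᵘ (pos 1) k)))))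

*-monoˡ : ∀ {r p q} → 0ℚ ≤ℚ r → p ≤ℚ q → r *ℚ p ≤ℚ r *ℚ q
*-monoˡ {r} 0≤r = ℚₚ.*-monoˡ-≤-nonNeg r {{nonNegative 0≤r}}

*-monoʳ : ∀ {r p q} → 0ℚ ≤ℚ r → p ≤ℚ q → p *ℚ r ≤ℚ q *ℚ r
*-monoʳ {r} 0≤r = ℚₚ.*-monoʳ-≤-nonNeg r {{nonNegative 0≤r}}

0≤* : ∀ {p q} → 0ℚ ≤ℚ p → 0ℚ ≤ℚ q → 0ℚ ≤ℚ p *ℚ q
0≤* {p} {q} 0≤p 0≤q = subst (_≤ℚ (p *ℚ q)) (ℚₚ.*-zeroʳ p) (*-monoˡ 0≤p 0≤q)

fraction-≤ : ∀ {a b c e} → 1 ≤ b → 1 ≤ e → a * e ≤ c * b → fromℕ a *ℚ recip b ≤ℚ fromℕ c *ℚ recip e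
fraction-≤ {a} {b} {c} {e} 1≤b 1≤e h = begin
  fromℕ a *ℚ recip b                              ≡⟨ extend a b e 1≤e ⟩
  fromℕ (a * e) *ℚ (recip b *ℚ recip e)           ≤⟨ *-monoʳ (0≤* (0≤recip b) (0≤recip e)) (fromℕ-mono h) ⟩
  fromℕ (c * b) *ℚ (recip b *ℚ recip e)           ≡⟨ cong (fromℕ (c * b) *ℚ_) (ℚₚ.*-comm (recip b) (recip e)) ⟩
  fromℕ (c * b) *ℚ (recip e *ℚ recip b)           ≡⟨ sym (extend c e b 1≤b) ⟩
  fromℕ c *ℚ recip e                              ∎
  where
  open ℚₚ.≤-Reasoning
  open ℚ-Solver hiding (⟦_⟧)
  extend : ∀ a b e → 1 ≤ e → fromℕ a *ℚ recip b ≡ fromℕ (a * e) *ℚ (recip b *ℚ recip e)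
  extend a b e 1≤e = trans (sym (ℚₚ.*-identityʳ _)) (trans (cong (fromℕ a *ℚ recip b *ℚ_) (sym (recip-inverse 1≤e)))
    (trans (solve 4 (λ a b e' e → a :* b :* (e' :* e) := a :* e :* (b :* e')) refl (fromℕ a) (recip b) (recip e) (fromℕ e))
      (cong (_*ℚ (recip b *ℚ recip e)) (sym (fromℕ-* a e)))))

p≤∣p∣ : ∀ p → p ≤ℚ ∣ p ∣
p≤∣p∣ p with ℚₚ.≤-total 0ℚ p
... | inj₁ 0≤p = ℚₚ.≤-reflexive (sym (ℚₚ.0≤p⇒∣p∣≡p 0≤p))
... | inj₂ p≤0 = ℚₚ.≤-trans p≤0 (ℚₚ.0≤∣p∣ p)

-- Finite sums of rationals

∑ : {A : Set} → List A → (A → ℚ) → ℚ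
∑ xs f = sumℚ (map f xs)

⟦_⟧ : Bool → ℚ
⟦ b ⟧ = if b then 1ℚ else 0ℚ

0≤⟦⟧ : ∀ b → 0ℚ ≤ℚ ⟦ b ⟧
0≤⟦⟧ true  = 0≤fromℕ 1
0≤⟦⟧ false = ℚₚ.≤-refl

module _ {A : Set} where

  ∑-cong : ∀ {f g : A → ℚ} → (∀ a → f a ≡ g a) → ∀ xs → ∑ xs f ≡ ∑ xs g
  ∑-cong h xs = cong sumℚ (Listₚ.map-cong h xs)

  ∑-mono : ∀ {f g : A → ℚ} xs → (∀ {a} → a ∈ xs → f a ≤ℚ g a) → ∑ xs f ≤ℚ ∑ xs g
  ∑-mono []       h = ℚₚ.≤-refl
  ∑-mono (x ∷ xs) h = ℚₚ.+-mono-≤ (h (here refl)) (∑-mono xs (h ∘ there))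

  ∑-+ : ∀ (f g : A → ℚ) xs → ∑ xs (λ a → f a +ℚ g a) ≡ ∑ xs f +ℚ ∑ xs g
  ∑-+ f g []       = refl
  ∑-+ f g (x ∷ xs) = trans (cong ((f x +ℚ g x) +ℚ_) (∑-+ f g xs))
    (solve 4 (λ a b c d → a :+ b :+ (c :+ d) := a :+ c :+ (b :+ d)) refl (f x) (g x) (∑ xs f) (∑ xs g))
    where open ℚ-Solver hiding (⟦_⟧)

  ∑-*ˡ : ∀ c (f : A → ℚ) xs → ∑ xs (λ a → c *ℚ f a) ≡ c *ℚ ∑ xs f
  ∑-*ˡ c f []       = sym (ℚₚ.*-zeroʳ c)
  ∑-*ˡ c f (x ∷ xs) = trans (cong (c *ℚ f x +ℚ_) (∑-*ˡ c f xs)) (sym (ℚₚ.*-distribˡ-+ c (f x) (∑ xs f)))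

  ∑-const : ∀ c (xs : List A) → ∑ xs (λ _ → c) ≡ fromℕ (length xs) *ℚ c
  ∑-const c []       = sym (ℚₚ.*-zeroˡ c)
  ∑-const c (x ∷ xs) = trans (cong (c +ℚ_) (∑-const c xs)) (trans
    (solve 2 (λ c n → c :+ n :* c := (con 1ℚ :+ n) :* c) refl c (fromℕ (length xs)))
    (cong (_*ℚ c) (sym (fromℕ-+ 1 (length xs)))))
    where open ℚ-Solver hiding (⟦_⟧)

  ∑-0 : ∀ (xs : List A) → ∑ xs (λ _ → 0ℚ) ≡ 0ℚ
  ∑-0 xs = trans (∑-const 0ℚ xs) (ℚₚ.*-zeroʳ (fromℕ (length xs)))

  ∑-select : ∀ (p : A → Bool) (f : A → ℚ) xs → ∑ (select p xs) f ≡ ∑ xs (λ a → if p a then f a else 0ℚ)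
  ∑-select p f [] = refl
  ∑-select p f (x ∷ xs) with p x
  ... | true  = cong (f x +ℚ_) (∑-select p f xs)
  ... | false = trans (∑-select p f xs) (sym (ℚₚ.+-identityˡ _))

  ∑-⟦⟧ : ∀ (p : A → Bool) xs → ∑ xs (λ a → ⟦ p a ⟧) ≡ fromℕ (count p xs)
  ∑-⟦⟧ p xs = trans (sym (∑-select p (λ _ → 1ℚ) xs)) (trans (∑-const 1ℚ (select p xs)) (ℚₚ.*-identityʳ _))

  fromℕ-sum : ∀ (f : A → ℕ) xs → ∑ xs (fromℕ ∘ f) ≡ fromℕ (sum (map f xs))
  fromℕ-sum f []       = refl
  fromℕ-sum f (x ∷ xs) = trans (cong (fromℕ (f x) +ℚ_) (fromℕ-sum f xs)) (sym (fromℕ-+ (f x) _))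

∑-swap : ∀ {A B : Set} (f : A → B → ℚ) xs ys → ∑ xs (λ a → ∑ ys (f a)) ≡ ∑ ys (λ b → ∑ xs (λ a → f a b))
∑-swap f []       ys = sym (∑-0 ys)
∑-swap f (x ∷ xs) ys = trans (cong (∑ ys (f x) +ℚ_) (∑-swap f xs ys)) (sym (h ys))
  where
  open ℚ-Solver hiding (⟦_⟧)
  h : ∀ ys → ∑ ys (λ b → f x b +ℚ ∑ xs (λ a → f a b)) ≡ ∑ ys (f x) +ℚ ∑ ys (λ b → ∑ xs (λ a → f a b))
  h []       = refl
  h (y ∷ ys) = trans (cong ((f x y +ℚ ∑ xs (λ a → f a y)) +ℚ_) (h ys))
    (solve 4 (λ a b c d → a :+ b :+ (c :+ d) := a :+ c :+ (b :+ d)) refl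
      (f x y) (∑ xs (λ a → f a y)) (∑ ys (f x)) (∑ ys (λ b → ∑ xs (λ a → f a b))))

∑-flip : ∀ {N} x (f : VSet N → ℚ) → ∑ (allSubsets N) (λ A → f (flipV A x)) ≡ ∑ (allSubsets N) f
∑-flip {N} x f = trans (cong sumℚ (Listₚ.map-∘ (allSubsets N)))
  (foldr-commMonoid ℚₚ.+-0-isCommutativeMonoid (↭⇒↭ₛ (↭ₚ.map⁺ f (allSubsets-flip x))))

card-≟ⱽ : ∀ {N} (A : VSet N) → card (A ≟ⱽ_) ≡ 1
card-≟ⱽ [] = refl
card-≟ⱽ {suc N} (b ∷ A) = trans (count-++ ((b ∷ A) ≟ⱽ_) (map (true ∷_) (allSubsets N)) (map (false ∷_) (allSubsets N)))
  (trans (cong₂ _+_ (count-map ((b ∷ A) ≟ⱽ_) (true ∷_) (allSubsets N)) (count-map ((b ∷ A) ≟ⱽ_) (false ∷_) (allSubsets N)))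
    (by-head b))
  where
  same : ∀ c → card (λ X → (c ∷ A) ≟ⱽ (c ∷ X)) ≡ 1
  same c = trans (count-cong (λ X → true-ext (λ e → ≟ⱽ⁺ (Vecₚ.∷-injectiveʳ (≟ⱽ⁻ {A = c ∷ A} {c ∷ X} e)))
    (λ e → ≟ⱽ⁺ {A = c ∷ A} {c ∷ X} (cong (c ∷_) (≟ⱽ⁻ e)))) (allSubsets N)) (card-≟ⱽ A)
  differ : ∀ c c' → c ≢ c' → card (λ X → (c ∷ A) ≟ⱽ (c' ∷ X)) ≡ 0
  differ c c' c≢c' = count-false (λ X → ¬-not λ e → c≢c' (Vecₚ.∷-injectiveˡ (≟ⱽ⁻ {A = c ∷ A} {c' ∷ X} e))) (allSubsets N)
  by-head : ∀ b → card (λ X → (b ∷ A) ≟ⱽ (true ∷ X)) + card (λ X → (b ∷ A) ≟ⱽ (false ∷ X)) ≡ 1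
  by-head true  = cong₂ _+_ (same true) (differ true false λ ())
  by-head false = cong₂ _+_ (differ false true λ ()) (same false)

∑-δ : ∀ {N} (u : VSet N → Bool) A → ∑ (select u (allSubsets N)) (λ X → ⟦ A ≟ⱽ X ⟧) ≡ ⟦ u A ⟧
∑-δ {N} u A = trans (∑-⟦⟧ (A ≟ⱽ_) (select u (allSubsets N)))
  (trans (cong fromℕ (count-select (A ≟ⱽ_) u (allSubsets N))) (by-value (u A) refl))
  where
  by-value : ∀ b → u A ≡ b → fromℕ (card (λ X → u X ∧ (A ≟ⱽ X))) ≡ ⟦ b ⟧
  by-value true  e = cong fromℕ (trans (count-cong (λ X → true-ext (λ h → proj₂ (∧-true⁻ {u X} h))
    (λ h → cong₂ _∧_ (trans (cong u (sym (≟ⱽ⁻ h))) e) h)) (allSubsets N)) (card-≟ⱽ A))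
  by-value false e = cong fromℕ (count-false (λ X → ¬-not λ h → let uX , A≡X = ∧-true⁻ {u X} h in
    contradiction (trans (sym uX) (trans (cong u (sym (≟ⱽ⁻ A≡X))) e)) λ ()) (allSubsets N))

-- The lazy flip walk as a linear operator

lazy-weights : ∀ {k} → 1 ≤ k → recip 2 +ℚ recip (2 * k) *ℚ fromℕ k ≡ 1ℚ
lazy-weights {k} 1≤k = begin
  recip 2 +ℚ r *ℚ fromℕ k
    ≡⟨ cong (λ p → recip 2 *ℚ p +ℚ r *ℚ fromℕ k) (trans (sym (recip-inverse 1≤2k)) (cong (r *ℚ_) (fromℕ-* 2 k))) ⟩
  recip 2 *ℚ (r *ℚ (fromℕ 2 *ℚ fromℕ k)) +ℚ r *ℚ fromℕ k
    ≡⟨ solve 2 (λ r k → con (recip 2) :* (r :* (con (fromℕ 2) :* k)) :+ r :* k := r :* (con (fromℕ 2) :* k)) refl r (fromℕ k) ⟩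
  r *ℚ (fromℕ 2 *ℚ fromℕ k)
    ≡⟨ trans (cong (r *ℚ_) (sym (fromℕ-* 2 k))) (recip-inverse 1≤2k) ⟩
  1ℚ ∎
  where
  open ≡-Reasoning
  open ℚ-Solver hiding (⟦_⟧)
  r = recip (2 * k)
  1≤2k : 1 ≤ 2 * k
  1≤2k = ℕₚ.≤-trans 1≤k (ℕₚ.m≤m+n k _)

module Walk-on (H : Graph) (1≤N : 1 ≤ size H) where

  N : ℕ
  N = size H

  r : ℚ
  r = recip (2 * N)

  0≤r : 0ℚ ≤ℚ r
  0≤r = 0≤recip (2 * N)

  lazy : ∀ p → recip 2 *ℚ p +ℚ r *ℚ (fromℕ N *ℚ p) ≡ p
  lazy p = trans (solve 4 (λ h r k p → h :* p :+ r :* (k :* p) := (h :+ r :* k) :* p) refl (recip 2) r (fromℕ N) p)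
    (trans (cong (_*ℚ p) (lazy-weights 1≤N)) (ℚₚ.*-identityˡ p))
    where open ℚ-Solver hiding (⟦_⟧)

  move : Fin N → VSet N → VSet N
  move x A = if isP2 H (flipV A x) then flipV A x else A

  ∑ⱽ : (Fin N → ℚ) → ℚ
  ∑ⱽ = ∑ (allFin N)

  ∑ᴾ : Dist H → ℚ
  ∑ᴾ = ∑ (P2 H)

  ∑ⱽ-const : ∀ c → ∑ⱽ (λ _ → c) ≡ fromℕ N *ℚ c
  ∑ⱽ-const c = trans (∑-const c (allFin N)) (cong (λ k → fromℕ k *ℚ c) (Listₚ.length-tabulate {n = N} id))

  step-move : ∀ μ A → step H μ A ≡ recip 2 *ℚ μ A +ℚ r *ℚ ∑ⱽ (λ x → μ (move x A))
  step-move μ A = cong (λ s → recip 2 *ℚ μ A +ℚ r *ℚ s)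
    (∑-cong (λ x → sym (if-float μ (isP2 H (flipV A x)))) (allFin N))

  flip-flip : ∀ (A : VSet N) x → flipV (flipV A x) x ≡ A
  flip-flip A x = trans (Vecₚ.updateAt-updateAt x A) (Vecₚ.updateAt-id-local x A (not-involutive _))

  -- Detailed balance: the pairs (A , move x A) with A ∈ P₂(H) form a symmetric relation.
  move-symmetric : ∀ x (Φ : VSet N → VSet N → ℚ) → ∑ᴾ (λ A → Φ A (move x A)) ≡ ∑ᴾ (λ A → Φ (move x A) A)
  move-symmetric x Φ = begin
    ∑ᴾ (λ A → Φ A (move x A))
      ≡⟨ split Φ (λ _ → refl) ⟩
    ∑ (allSubsets N) (moved Φ) +ℚ ∑ (allSubsets N) stuck
      ≡⟨ cong (_+ℚ ∑ (allSubsets N) stuck) (trans (sym (∑-flip x (moved Φ))) (∑-cong moved-flip (allSubsets N))) ⟩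
    ∑ (allSubsets N) (moved (λ A B → Φ B A)) +ℚ ∑ (allSubsets N) stuck
      ≡⟨ sym (split (λ A B → Φ B A) (λ _ → refl)) ⟩
    ∑ᴾ (λ A → Φ (move x A) A) ∎
    where
    open ≡-Reasoning
    moved : (VSet N → VSet N → ℚ) → VSet N → ℚ
    moved Ψ A = if isP2 H A ∧ isP2 H (flipV A x) then Ψ A (flipV A x) else 0ℚ
    stuck : VSet N → ℚ
    stuck A = if isP2 H A ∧ not (isP2 H (flipV A x)) then Φ A A else 0ℚ
    split-if : ∀ (Ψ : VSet N → VSet N → ℚ) {A B q} → Ψ A A ≡ q → ∀ a b →
      (if a then Ψ A (if b then B else A) else 0ℚ) ≡ (if a ∧ b then Ψ A B else 0ℚ) +ℚ (if a ∧ not b then q else 0ℚ)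
    split-if Ψ e false b     = refl
    split-if Ψ e true  true  = sym (ℚₚ.+-identityʳ _)
    split-if Ψ e true  false = trans e (sym (ℚₚ.+-identityˡ _))
    split : ∀ (Ψ : VSet N → VSet N → ℚ) → (∀ A → Ψ A A ≡ Φ A A) →
      ∑ᴾ (λ A → Ψ A (move x A)) ≡ ∑ (allSubsets N) (moved Ψ) +ℚ ∑ (allSubsets N) stuck
    split Ψ e = trans (∑-select (isP2 H) _ (allSubsets N))
      (trans (∑-cong (λ A → split-if Ψ (e A) (isP2 H A) (isP2 H (flipV A x))) (allSubsets N)) (∑-+ (moved Ψ) stuck (allSubsets N)))
    moved-flip : ∀ A → moved Φ (flipV A x) ≡ moved (λ A B → Φ B A) A
    moved-flip A = cong₂ (λ B c → if c then Φ (flipV A x) B else 0ℚ) (flip-flip A x)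
      (trans (cong (λ B → isP2 H (flipV A x) ∧ isP2 H B) (flip-flip A x)) (∧-comm (isP2 H (flipV A x)) (isP2 H A)))

  -- Self-adjointness: detailed balance shifts the step from `μ` to the test function `g`. The
  -- constant `g` gives conservation of mass, and the indicator of the complement of `U` gives the
  -- growth of the escaped mass.
  step-pairing : ∀ (g μ : Dist H) → ∑ᴾ (λ A → g A *ℚ step H μ A) ≡
    recip 2 *ℚ ∑ᴾ (λ A → g A *ℚ μ A) +ℚ r *ℚ ∑ⱽ (λ x → ∑ᴾ (λ A → g (move x A) *ℚ μ A))
  step-pairing g μ = begin
    ∑ᴾ (λ A → g A *ℚ step H μ A)
      ≡⟨ ∑-cong (λ A → trans (cong (g A *ℚ_) (step-move μ A)) (expand A)) (P2 H) ⟩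
    ∑ᴾ (λ A → recip 2 *ℚ (g A *ℚ μ A) +ℚ r *ℚ ∑ⱽ (λ x → g A *ℚ μ (move x A)))
      ≡⟨ trans (∑-+ (λ A → recip 2 *ℚ (g A *ℚ μ A)) _ (P2 H)) (cong₂ _+ℚ_
           (∑-*ˡ (recip 2) (λ A → g A *ℚ μ A) (P2 H)) (∑-*ˡ r (λ A → ∑ⱽ (λ x → g A *ℚ μ (move x A))) (P2 H))) ⟩
    recip 2 *ℚ ∑ᴾ (λ A → g A *ℚ μ A) +ℚ r *ℚ ∑ᴾ (λ A → ∑ⱽ (λ x → g A *ℚ μ (move x A)))
      ≡⟨ cong (λ s → recip 2 *ℚ ∑ᴾ (λ A → g A *ℚ μ A) +ℚ r *ℚ s) (trans
           (∑-swap (λ A x → g A *ℚ μ (move x A)) (P2 H) (allFin N))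
           (∑-cong (λ x → move-symmetric x (λ A B → g A *ℚ μ B)) (allFin N))) ⟩
    recip 2 *ℚ ∑ᴾ (λ A → g A *ℚ μ A) +ℚ r *ℚ ∑ⱽ (λ x → ∑ᴾ (λ A → g (move x A) *ℚ μ A)) ∎
    where
    open ≡-Reasoning
    open ℚ-Solver hiding (⟦_⟧)
    expand : ∀ A → g A *ℚ (recip 2 *ℚ μ A +ℚ r *ℚ ∑ⱽ (λ x → μ (move x A))) ≡
      recip 2 *ℚ (g A *ℚ μ A) +ℚ r *ℚ ∑ⱽ (λ x → g A *ℚ μ (move x A))
    expand A = trans (solve 5 (λ g h m r s → g :* (h :* m :+ r :* s) := h :* (g :* m) :+ r :* (g :* s)) refl
        (g A) (recip 2) (μ A) r (∑ⱽ (λ x → μ (move x A))))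
      (cong (λ s → recip 2 *ℚ (g A *ℚ μ A) +ℚ r *ℚ s) (sym (∑-*ˡ (g A) (λ x → μ (move x A)) (allFin N))))

  step-mass : ∀ μ → ∑ᴾ (step H μ) ≡ ∑ᴾ μ
  step-mass μ = begin
    ∑ᴾ (step H μ)
      ≡⟨ ∑-cong (λ A → sym (ℚₚ.*-identityˡ (step H μ A))) (P2 H) ⟩
    ∑ᴾ (λ A → 1ℚ *ℚ step H μ A)
      ≡⟨ step-pairing (λ _ → 1ℚ) μ ⟩
    recip 2 *ℚ ∑ᴾ (λ A → 1ℚ *ℚ μ A) +ℚ r *ℚ ∑ⱽ (λ x → ∑ᴾ (λ A → 1ℚ *ℚ μ A))
      ≡⟨ cong (λ s → recip 2 *ℚ ∑ᴾ (λ A → 1ℚ *ℚ μ A) +ℚ r *ℚ s) (∑ⱽ-const _) ⟩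
    recip 2 *ℚ ∑ᴾ (λ A → 1ℚ *ℚ μ A) +ℚ r *ℚ (fromℕ N *ℚ ∑ᴾ (λ A → 1ℚ *ℚ μ A))
      ≡⟨ lazy _ ⟩
    ∑ᴾ (λ A → 1ℚ *ℚ μ A)
      ≡⟨ ∑-cong (λ A → ℚₚ.*-identityˡ (μ A)) (P2 H) ⟩
    ∑ᴾ μ ∎
    where open ≡-Reasoning

  iter-mass : ∀ t μ → ∑ᴾ (iter H t μ) ≡ ∑ᴾ μ
  iter-mass zero    μ = refl
  iter-mass (suc t) μ = trans (step-mass (iter H t μ)) (iter-mass t μ)

  step-cong : ∀ {μ ν} → (∀ A → μ A ≡ ν A) → ∀ A → step H μ A ≡ step H ν A
  step-cong {μ} {ν} h A = trans (step-move μ A) (trans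
    (cong₂ (λ p q → recip 2 *ℚ p +ℚ r *ℚ q) (h A) (∑-cong (λ x → h (move x A)) (allFin N))) (sym (step-move ν A)))

  step-∑ : ∀ {I : Set} (φ : I → Dist H) L A → step H (λ A → ∑ L (λ i → φ i A)) A ≡ ∑ L (λ i → step H (φ i) A)
  step-∑ φ L A = sym (begin
    ∑ L (λ i → step H (φ i) A)
      ≡⟨ trans (∑-cong (λ i → step-move (φ i) A) L) (∑-+ (λ i → recip 2 *ℚ φ i A) _ L) ⟩
    ∑ L (λ i → recip 2 *ℚ φ i A) +ℚ ∑ L (λ i → r *ℚ ∑ⱽ (λ x → φ i (move x A)))
      ≡⟨ cong₂ _+ℚ_ (∑-*ˡ (recip 2) (λ i → φ i A) L) (trans (∑-*ˡ r (λ i → ∑ⱽ (λ x → φ i (move x A))) L)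
           (cong (r *ℚ_) (∑-swap (λ i x → φ i (move x A)) L (allFin N)))) ⟩
    recip 2 *ℚ ∑ L (λ i → φ i A) +ℚ r *ℚ ∑ⱽ (λ x → ∑ L (λ i → φ i (move x A)))
      ≡⟨ sym (step-move (λ A → ∑ L (λ i → φ i A)) A) ⟩
    step H (λ A → ∑ L (λ i → φ i A)) A ∎)
    where open ≡-Reasoning

  iter-∑ : ∀ {I : Set} t (φ : I → Dist H) L A → iter H t (λ A → ∑ L (λ i → φ i A)) A ≡ ∑ L (λ i → iter H t (φ i) A)
  iter-∑ zero    φ L A = refl
  iter-∑ (suc t) φ L A = trans (step-cong (iter-∑ t φ L) A) (step-∑ (λ i → iter H t (φ i)) L A)

  InUnit : Dist H → Set
  InUnit μ = ∀ A → 0ℚ ≤ℚ μ A × μ A ≤ℚ 1ℚ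

  -- By the symmetry of the walk, `step` replaces each value of `μ` by a weighted average of values
  -- of `μ`; the weights sum to 1, so constant bounds survive.
  step-inUnit : ∀ {μ} → InUnit μ → InUnit (step H μ)
  step-inUnit {μ} h A = lower , upper
    where
    open ℚₚ.≤-Reasoning
    average : ∀ c → recip 2 *ℚ c +ℚ r *ℚ ∑ⱽ (λ _ → c) ≡ c
    average c = trans (cong (λ s → recip 2 *ℚ c +ℚ r *ℚ s) (∑ⱽ-const c)) (lazy c)
    lower : 0ℚ ≤ℚ step H μ A
    lower = begin
      0ℚ                                          ≡⟨ sym (average 0ℚ) ⟩
      recip 2 *ℚ 0ℚ +ℚ r *ℚ ∑ⱽ (λ _ → 0ℚ)         ≤⟨ ℚₚ.+-mono-≤ (*-monoˡ (0≤recip 2) (proj₁ (h A)))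
                                                     (*-monoˡ 0≤r (∑-mono (allFin N) λ {x} _ → proj₁ (h (move x A)))) ⟩
      recip 2 *ℚ μ A +ℚ r *ℚ ∑ⱽ (λ x → μ (move x A)) ≡⟨ sym (step-move μ A) ⟩
      step H μ A                                  ∎
    upper : step H μ A ≤ℚ 1ℚ
    upper = begin
      step H μ A                                  ≡⟨ step-move μ A ⟩
      recip 2 *ℚ μ A +ℚ r *ℚ ∑ⱽ (λ x → μ (move x A)) ≤⟨ ℚₚ.+-mono-≤ (*-monoˡ (0≤recip 2) (proj₂ (h A)))
                                                     (*-monoˡ 0≤r (∑-mono (allFin N) λ {x} _ → proj₂ (h (move x A)))) ⟩
      recip 2 *ℚ 1ℚ +ℚ r *ℚ ∑ⱽ (λ _ → 1ℚ)         ≡⟨ average 1ℚ ⟩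
      1ℚ                                          ∎

  iter-inUnit : ∀ t {μ} → InUnit μ → InUnit (iter H t μ)
  iter-inUnit zero    h = h
  iter-inUnit (suc t) h = step-inUnit (iter-inUnit t h)

  -- Mass escaping from a set of states

  module Escape (u : VSet N → Bool) (u⇒P2 : ∀ A → u A ≡ true → InP2 H A) where

    U : List (VSet N)
    U = select u (allSubsets N)

    outside : Dist H
    outside A = ⟦ not (u A) ⟧

    escaped : Dist H → ℚ
    escaped μ = ∑ᴾ (λ A → outside A *ℚ μ A)

    -- A state of `U` contributes on the left only when flipping `x` crosses the boundary, and then
    -- at most 1 because `μ` is bounded by 1. This is how a number of states comes to bound a mass.
    -- States that move into `U` only lower the left side.
    escape-via : ∀ x {μ} → InUnit μ → ∑ᴾ (λ A → outside (move x A) *ℚ μ A) ≤ℚ escaped μ +ℚ fromℕ (card (crossing H u x))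
    escape-via x {μ} h = begin
      ∑ᴾ (λ A → outside (move x A) *ℚ μ A)
        ≤⟨ ∑-mono (P2 H) (λ {A} _ → at A) ⟩
      ∑ᴾ (λ A → outside A *ℚ μ A +ℚ ⟦ crossing H u x A ⟧)
        ≡⟨ trans (∑-+ (λ A → outside A *ℚ μ A) _ (P2 H)) (cong (escaped μ +ℚ_) (trans (∑-⟦⟧ (crossing H u x) (P2 H))
             (cong fromℕ (count-select (crossing H u x) (isP2 H) (allSubsets N))))) ⟩
      escaped μ +ℚ fromℕ (card (λ A → isP2 H A ∧ crossing H u x A))
        ≤⟨ ℚₚ.+-monoʳ-≤ (escaped μ) (fromℕ-mono (count-mono (λ A e → proj₂ (∧-true⁻ {isP2 H A} e)) (allSubsets N))) ⟩
      escaped μ +ℚ fromℕ (card (crossing H u x)) ∎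
      where
      open ℚₚ.≤-Reasoning
      stay : ∀ {p} b → 0ℚ ≤ℚ p → ⟦ not b ⟧ *ℚ p ≤ℚ ⟦ not b ⟧ *ℚ p +ℚ ⟦ b ∧ false ⟧
      stay {p} b 0≤p = ℚₚ.≤-reflexive (sym (trans (cong (λ c → ⟦ not b ⟧ *ℚ p +ℚ ⟦ c ⟧) (∧-zeroʳ b)) (ℚₚ.+-identityʳ _)))
      cross : ∀ {p} b c → 0ℚ ≤ℚ p → p ≤ℚ 1ℚ → ⟦ not c ⟧ *ℚ p ≤ℚ ⟦ not b ⟧ *ℚ p +ℚ ⟦ b ∧ not c ⟧
      cross {p} true  true  0≤p p≤1 = ℚₚ.≤-reflexive (sym (ℚₚ.+-identityʳ _))
      cross {p} true  false 0≤p p≤1 = ℚₚ.≤-trans (ℚₚ.≤-reflexive (ℚₚ.*-identityˡ p))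
        (ℚₚ.≤-trans p≤1 (ℚₚ.≤-reflexive (sym (trans (cong (_+ℚ 1ℚ) (ℚₚ.*-zeroˡ p)) (ℚₚ.+-identityˡ 1ℚ)))))
      cross {p} false true  0≤p p≤1 = ℚₚ.≤-trans (ℚₚ.≤-reflexive (ℚₚ.*-zeroˡ p))
        (ℚₚ.≤-trans 0≤p (ℚₚ.≤-reflexive (sym (trans (ℚₚ.+-identityʳ _) (ℚₚ.*-identityˡ p)))))
      cross {p} false false 0≤p p≤1 = ℚₚ.≤-reflexive (sym (ℚₚ.+-identityʳ _))
      at-move : ∀ A b → 0ℚ ≤ℚ μ A → μ A ≤ℚ 1ℚ → outside (if b then flipV A x else A) *ℚ μ A ≤ℚ
        outside A *ℚ μ A +ℚ ⟦ u A ∧ (b ∧ not (u (flipV A x))) ⟧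
      at-move A true  = cross (u A) (u (flipV A x))
      at-move A false = λ 0≤p _ → stay (u A) 0≤p
      at : ∀ A → outside (move x A) *ℚ μ A ≤ℚ outside A *ℚ μ A +ℚ ⟦ crossing H u x A ⟧
      at A = at-move A (isP2 H (flipV A x)) (proj₁ (h A)) (proj₂ (h A))

    escape-step : ∀ {μ} → InUnit μ → escaped (step H μ) ≤ℚ escaped μ +ℚ r *ℚ fromℕ (crossings H u)
    escape-step {μ} h = begin
      escaped (step H μ)
        ≡⟨ step-pairing outside μ ⟩
      recip 2 *ℚ escaped μ +ℚ r *ℚ ∑ⱽ (λ x → ∑ᴾ (λ A → outside (move x A) *ℚ μ A))
        ≤⟨ ℚₚ.+-monoʳ-≤ (recip 2 *ℚ escaped μ) (*-monoˡ 0≤r (∑-mono (allFin N) λ {x} _ → escape-via x h)) ⟩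
      recip 2 *ℚ escaped μ +ℚ r *ℚ ∑ⱽ (λ x → escaped μ +ℚ fromℕ (card (crossing H u x)))
        ≡⟨ cong (λ s → recip 2 *ℚ escaped μ +ℚ r *ℚ s) (trans
             (∑-+ (λ _ → escaped μ) (λ x → fromℕ (card (crossing H u x))) (allFin N))
             (cong₂ _+ℚ_ (∑ⱽ-const (escaped μ)) (fromℕ-sum (λ x → card (crossing H u x)) (allFin N)))) ⟩
      recip 2 *ℚ escaped μ +ℚ r *ℚ (fromℕ N *ℚ escaped μ +ℚ fromℕ (crossings H u))
        ≡⟨ solve 5 (λ h e r k b → h :* e :+ r :* (k :* e :+ b) := h :* e :+ r :* (k :* e) :+ r :* b) refl
             (recip 2) (escaped μ) r (fromℕ N) (fromℕ (crossings H u)) ⟩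
      recip 2 *ℚ escaped μ +ℚ r *ℚ (fromℕ N *ℚ escaped μ) +ℚ r *ℚ fromℕ (crossings H u)
        ≡⟨ cong (_+ℚ r *ℚ fromℕ (crossings H u)) (lazy (escaped μ)) ⟩
      escaped μ +ℚ r *ℚ fromℕ (crossings H u) ∎
      where
      open ℚₚ.≤-Reasoning
      open ℚ-Solver hiding (⟦_⟧)

    escape-iter : ∀ t {μ} → InUnit μ → escaped (iter H t μ) ≤ℚ escaped μ +ℚ fromℕ t *ℚ (r *ℚ fromℕ (crossings H u))
    escape-iter zero {μ} h = ℚₚ.≤-reflexive (sym (trans (cong (escaped μ +ℚ_) (ℚₚ.*-zeroˡ (r *ℚ fromℕ (crossings H u)))) (ℚₚ.+-identityʳ (escaped μ))))
    escape-iter (suc t) {μ} h = begin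
      escaped (iter H (suc t) μ)
        ≤⟨ escape-step (iter-inUnit t h) ⟩
      escaped (iter H t μ) +ℚ q
        ≤⟨ ℚₚ.+-monoˡ-≤ q (escape-iter t h) ⟩
      escaped μ +ℚ fromℕ t *ℚ q +ℚ q
        ≡⟨ solve 3 (λ e t q → e :+ t :* q :+ q := e :+ (con 1ℚ :+ t) :* q) refl (escaped μ) (fromℕ t) q ⟩
      escaped μ +ℚ (1ℚ +ℚ fromℕ t) *ℚ q
        ≡⟨ cong (λ k → escaped μ +ℚ k *ℚ q) (sym (fromℕ-+ 1 t)) ⟩
      escaped μ +ℚ fromℕ (suc t) *ℚ q ∎
      where
      open ℚₚ.≤-Reasoning
      open ℚ-Solver hiding (⟦_⟧)
      q = r *ℚ fromℕ (crossings H u)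

    initial : Dist H
    initial A = ∑ U (λ X → δ H X A)

    initial≡ : ∀ A → initial A ≡ ⟦ u A ⟧
    initial≡ A = ∑-δ u A

    initial-inUnit : InUnit initial
    initial-inUnit A = subst (λ p → 0ℚ ≤ℚ p × p ≤ℚ 1ℚ) (sym (initial≡ A)) (0≤⟦⟧ (u A) , ⟦⟧≤1 (u A))
      where
      ⟦⟧≤1 : ∀ b → ⟦ b ⟧ ≤ℚ 1ℚ
      ⟦⟧≤1 true  = ℚₚ.≤-refl
      ⟦⟧≤1 false = 0≤fromℕ 1

    escaped-initial : escaped initial ≡ 0ℚ
    escaped-initial = trans (∑-cong (λ A → trans (cong (outside A *ℚ_) (initial≡ A)) (disjoint (u A))) (P2 H)) (∑-0 (P2 H))
      where
      disjoint : ∀ b → ⟦ not b ⟧ *ℚ ⟦ b ⟧ ≡ 0ℚ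
      disjoint true  = refl
      disjoint false = refl

    -- By linearity the runs from all states of `U` form a single run from `initial`, whose masses
    -- are still at most 1. Applying `escape-iter` to each start separately would lose a factor
    -- `card u`.
    escape-total : ∀ t → ∑ U (λ X → escaped (iter H t (δ H X))) ≤ℚ fromℕ t *ℚ (r *ℚ fromℕ (crossings H u))
    escape-total t = begin
      ∑ U (λ X → escaped (iter H t (δ H X)))
        ≡⟨ ∑-swap (λ X A → outside A *ℚ iter H t (δ H X) A) U (P2 H) ⟩
      ∑ᴾ (λ A → ∑ U (λ X → outside A *ℚ iter H t (δ H X) A))
        ≡⟨ ∑-cong (λ A → trans (∑-*ˡ (outside A) (λ X → iter H t (δ H X) A) U)
             (cong (outside A *ℚ_) (sym (iter-∑ t (δ H) U A)))) (P2 H) ⟩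
      escaped (iter H t initial)
        ≤⟨ escape-iter t initial-inUnit ⟩
      escaped initial +ℚ fromℕ t *ℚ (r *ℚ fromℕ (crossings H u))
        ≡⟨ trans (cong (_+ℚ fromℕ t *ℚ (r *ℚ fromℕ (crossings H u))) escaped-initial) (ℚₚ.+-identityˡ _) ⟩
      fromℕ t *ℚ (r *ℚ fromℕ (crossings H u)) ∎
      where open ℚₚ.≤-Reasoning

    -- Consequences for a set of at most half of the states

    module Balanced (1≤u : 1 ≤ card u) (2u≤P2 : 2 * card u ≤ length (P2 H)) where

      c : ℚ
      c = recip (length (P2 H))

      1≤P2 : 1 ≤ length (P2 H)
      1≤P2 = ℕₚ.≤-trans 1≤u (ℕₚ.≤-trans (ℕₚ.m≤m+n (card u) _) 2u≤P2)

      ∑ᴾ-uniform : ∑ᴾ (uniform H) ≡ 1ℚ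
      ∑ᴾ-uniform = trans (∑-const c (P2 H)) (trans (ℚₚ.*-comm (fromℕ (length (P2 H))) c) (recip-inverse 1≤P2))

      outside-majority : length (P2 H) ≤ 2 * count (λ A → not (u A)) (P2 H)
      outside-majority = begin
        length (P2 H)         ≡⟨ total ⟩
        in-u + out            ≤⟨ ℕₚ.+-monoˡ-≤ out in≤out ⟩
        out + out             ≡⟨ cong (out +_) (sym (ℕₚ.+-identityʳ out)) ⟩
        2 * out               ∎
        where
        open ℕₚ.≤-Reasoning
        in-u out : ℕ
        in-u = card (λ A → isP2 H A ∧ u A)
        out = count (λ A → not (u A)) (P2 H)
        total : length (P2 H) ≡ in-u + out
        total = trans (count-split (isP2 H) u (allSubsets N))
          (cong (in-u +_) (sym (count-select (λ A → not (u A)) (isP2 H) (allSubsets N))))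
        in≤out : in-u ≤ out
        in≤out = ℕₚ.+-cancelˡ-≤ in-u in-u out (begin
          in-u + in-u         ≡⟨ cong (in-u +_) (sym (ℕₚ.+-identityʳ in-u)) ⟩
          2 * in-u            ≤⟨ ℕₚ.*-monoʳ-≤ 2 (count-mono (λ A e → proj₂ (∧-true⁻ {isP2 H A} e)) (allSubsets N)) ⟩
          2 * card u          ≤⟨ 2u≤P2 ⟩
          length (P2 H)       ≡⟨ total ⟩
          in-u + out          ∎)

      escaped-uniform : 1ℚ ≤ℚ fromℕ 2 *ℚ escaped (uniform H)
      escaped-uniform = begin
        1ℚ                                    ≡⟨ sym (recip-inverse 1≤P2) ⟩
        c *ℚ fromℕ (length (P2 H))            ≤⟨ *-monoˡ (0≤recip (length (P2 H))) (fromℕ-mono outside-majority) ⟩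
        c *ℚ fromℕ (2 * K)                    ≡⟨ cong (c *ℚ_) (fromℕ-* 2 K) ⟩
        c *ℚ (fromℕ 2 *ℚ fromℕ K)             ≡⟨ solve 3 (λ c t k → c :* (t :* k) := t :* (c :* k)) refl c (fromℕ 2) (fromℕ K) ⟩
        fromℕ 2 *ℚ (c *ℚ fromℕ K)             ≡⟨ cong (λ s → fromℕ 2 *ℚ (c *ℚ s)) (sym (∑-⟦⟧ (λ A → not (u A)) (P2 H))) ⟩
        fromℕ 2 *ℚ (c *ℚ ∑ᴾ outside)          ≡⟨ cong (fromℕ 2 *ℚ_) (trans (sym (∑-*ˡ c outside (P2 H)))
                                                   (∑-cong (λ A → ℚₚ.*-comm c (outside A)) (P2 H))) ⟩
        fromℕ 2 *ℚ escaped (uniform H)        ∎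
        where
        open ℚₚ.≤-Reasoning
        open ℚ-Solver hiding (⟦_⟧)
        K = count (λ A → not (u A)) (P2 H)

      -- Total variation is tested against the indicator of the complement of U.
      mixed⇒escaped : ∀ p → ∑ᴾ p ≡ 1ℚ → TV H p (uniform H) ≤ℚ recip 4 → recip 4 ≤ℚ escaped p
      mixed⇒escaped p mass tv = begin
        recip 4
          ≡⟨⟩
        recip 2 *ℚ (1ℚ +ℚ 1ℚ +ℚ s)
          ≤⟨ *-monoˡ (0≤recip 2) (ℚₚ.+-monoˡ-≤ s tested) ⟩
        recip 2 *ℚ (fromℕ 2 *ℚ escaped p +ℚ (1ℚ +ℚ recip 2) +ℚ s)
          ≡⟨ solve 1 (λ e → con (recip 2) :* (con (fromℕ 2) :* e :+ (con 1ℚ :+ con (recip 2)) :+ con s) := e) refl (escaped p) ⟩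
        escaped p ∎
        where
        open ℚₚ.≤-Reasoning
        open ℚ-Solver hiding (⟦_⟧)
        -- Here 3/2 is the mass 1 of the uniform distribution plus the bound 1/2 on `∑ᴾ distance`.
        -- Adding its negative isolates `escaped p`, and half of `1 + 1 - 3/2` is the claimed 1/4.
        s : ℚ
        s = - (1ℚ +ℚ recip 2)
        distance : Dist H
        distance A = ∣ p A - uniform H A ∣
        distance≤ : ∑ᴾ distance ≤ℚ recip 2
        distance≤ = begin
          ∑ᴾ distance                               ≡⟨ solve 1 (λ t → t := con (fromℕ 2) :* (con (recip 2) :* t)) refl (∑ᴾ distance) ⟩
          fromℕ 2 *ℚ (recip 2 *ℚ ∑ᴾ distance)       ≤⟨ *-monoˡ (0≤fromℕ 2) tv ⟩
          fromℕ 2 *ℚ recip 4                        ≡⟨⟩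
          recip 2                                   ∎
        -- This is `c - q ≤ ∣ q - c ∣` or `q - c ≤ ∣ q - c ∣`, according to `b`, rearranged for
        -- summation. As `p` and the uniform distribution both have mass 1, the sum bounds twice the
        -- difference of their escaped masses, and this 2 cancels the `recip 2` in `TV`.
        test : ∀ b q → fromℕ 2 *ℚ (⟦ b ⟧ *ℚ c) +ℚ q ≤ℚ fromℕ 2 *ℚ (⟦ b ⟧ *ℚ q) +ℚ (c +ℚ ∣ q - c ∣)
        test true q = begin
          fromℕ 2 *ℚ (1ℚ *ℚ c) +ℚ q
            ≡⟨ solve 2 (λ c q → con (fromℕ 2) :* (con 1ℚ :* c) :+ q := con (fromℕ 2) :* (con 1ℚ :* q) :+ (c :+ :- (q :- c))) refl c q ⟩
          fromℕ 2 *ℚ (1ℚ *ℚ q) +ℚ (c +ℚ - (q - c))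
            ≤⟨ ℚₚ.+-monoʳ-≤ (fromℕ 2 *ℚ (1ℚ *ℚ q)) (ℚₚ.+-monoʳ-≤ c
                 (subst (- (q - c) ≤ℚ_) (ℚₚ.∣-p∣≡∣p∣ (q - c)) (p≤∣p∣ (- (q - c))))) ⟩
          fromℕ 2 *ℚ (1ℚ *ℚ q) +ℚ (c +ℚ ∣ q - c ∣) ∎
        test false q = begin
          fromℕ 2 *ℚ (0ℚ *ℚ c) +ℚ q
            ≡⟨ solve 2 (λ c q → con (fromℕ 2) :* (con 0ℚ :* c) :+ q := con (fromℕ 2) :* (con 0ℚ :* q) :+ (c :+ (q :- c))) refl c q ⟩
          fromℕ 2 *ℚ (0ℚ *ℚ q) +ℚ (c +ℚ (q - c))
            ≤⟨ ℚₚ.+-monoʳ-≤ (fromℕ 2 *ℚ (0ℚ *ℚ q)) (ℚₚ.+-monoʳ-≤ c (p≤∣p∣ (q - c))) ⟩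
          fromℕ 2 *ℚ (0ℚ *ℚ q) +ℚ (c +ℚ ∣ q - c ∣) ∎
        tested : 1ℚ +ℚ 1ℚ ≤ℚ fromℕ 2 *ℚ escaped p +ℚ (1ℚ +ℚ recip 2)
        tested = begin
          1ℚ +ℚ 1ℚ
            ≤⟨ ℚₚ.+-mono-≤ escaped-uniform (ℚₚ.≤-reflexive (sym mass)) ⟩
          fromℕ 2 *ℚ escaped (uniform H) +ℚ ∑ᴾ p
            ≡⟨ sym (trans (∑-+ (λ A → fromℕ 2 *ℚ (outside A *ℚ c)) p (P2 H))
                 (cong (_+ℚ ∑ᴾ p) (∑-*ˡ (fromℕ 2) (λ A → outside A *ℚ c) (P2 H)))) ⟩
          ∑ᴾ (λ A → fromℕ 2 *ℚ (outside A *ℚ c) +ℚ p A)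
            ≤⟨ ∑-mono (P2 H) (λ {A} _ → test (not (u A)) (p A)) ⟩
          ∑ᴾ (λ A → fromℕ 2 *ℚ (outside A *ℚ p A) +ℚ (c +ℚ distance A))
            ≡⟨ trans (∑-+ (λ A → fromℕ 2 *ℚ (outside A *ℚ p A)) (λ A → c +ℚ distance A) (P2 H)) (cong₂ _+ℚ_
                 (∑-*ˡ (fromℕ 2) (λ A → outside A *ℚ p A) (P2 H)) (∑-+ (uniform H) distance (P2 H))) ⟩
          fromℕ 2 *ℚ escaped p +ℚ (∑ᴾ (uniform H) +ℚ ∑ᴾ distance)
            ≤⟨ ℚₚ.+-monoʳ-≤ (fromℕ 2 *ℚ escaped p) (ℚₚ.+-mono-≤ (ℚₚ.≤-reflexive ∑ᴾ-uniform) distance≤) ⟩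
          fromℕ 2 *ℚ escaped p +ℚ (1ℚ +ℚ recip 2) ∎

      ∑ᴾ-δ : ∀ X → InP2 H X → ∑ᴾ (δ H X) ≡ 1ℚ
      ∑ᴾ-δ X pX = trans (∑-cong (λ A → cong ⟦_⟧ (true-ext (≟ⱽ⁺ ∘ sym ∘ ≟ⱽ⁻ {A = A} {X}) (≟ⱽ⁺ ∘ sym ∘ ≟ⱽ⁻ {A = X} {A}))) (P2 H))
        (trans (∑-δ (isP2 H) X) (cong ⟦_⟧ pX))

      -- Each of the `card u` starts has lost at least 1/4, and all together have lost at most
      -- `t * crossings H u / (2 * N)`. Multiplication by `4 * N` leaves the factor 2 on the right.
      mixed⇒slow : ∀ t → MixedBy H (recip 4) t → card u * N ≤ 2 * (t * crossings H u)
      mixed⇒slow t mixed = fromℕ-cancel-≤ (begin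
        fromℕ (card u * N)
          ≡⟨ fromℕ-* (card u) N ⟩
        fromℕ (card u) *ℚ fromℕ N
          ≡⟨ solve 2 (λ a n → a :* n := con (fromℕ 4) :* n :* (a :* con (recip 4))) refl (fromℕ (card u)) (fromℕ N) ⟩
        fromℕ 4 *ℚ fromℕ N *ℚ (fromℕ (card u) *ℚ recip 4)
          ≤⟨ *-monoˡ (0≤* (0≤fromℕ 4) (0≤fromℕ N)) escapes ⟩
        fromℕ 4 *ℚ fromℕ N *ℚ (fromℕ t *ℚ (r *ℚ fromℕ B))
          ≡⟨ solve 4 (λ n t r b → con (fromℕ 4) :* n :* (t :* (r :* b)) := r :* (con (fromℕ 2) :* n) :* (con (fromℕ 2) :* (t :* b)))
               refl (fromℕ N) (fromℕ t) r (fromℕ B) ⟩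
        r *ℚ (fromℕ 2 *ℚ fromℕ N) *ℚ (fromℕ 2 *ℚ (fromℕ t *ℚ fromℕ B))
          ≡⟨ cong₂ _*ℚ_ (trans (cong (r *ℚ_) (sym (fromℕ-* 2 N))) (recip-inverse (ℕₚ.≤-trans 1≤N (ℕₚ.m≤m+n N _))))
               (trans (cong (fromℕ 2 *ℚ_) (sym (fromℕ-* t B))) (sym (fromℕ-* 2 (t * B)))) ⟩
        1ℚ *ℚ fromℕ (2 * (t * B))
          ≡⟨ ℚₚ.*-identityˡ _ ⟩
        fromℕ (2 * (t * B)) ∎)
        where
        open ℚₚ.≤-Reasoning
        open ℚ-Solver hiding (⟦_⟧)
        B = crossings H u
        escapes : fromℕ (card u) *ℚ recip 4 ≤ℚ fromℕ t *ℚ (r *ℚ fromℕ B)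
        escapes = begin
          fromℕ (card u) *ℚ recip 4
            ≡⟨ sym (∑-const (recip 4) U) ⟩
          ∑ U (λ _ → recip 4)
            ≤⟨ ∑-mono U (λ {X} X∈U → let pX = u⇒P2 X (proj₂ (∈-select⁻ u (allSubsets N) X∈U)) in
                 mixed⇒escaped (iter H t (δ H X)) (trans (iter-mass t (δ H X)) (∑ᴾ-δ X pX))
                   (mixed X (∈-select⁺ (isP2 H) (∈-allSubsets X) pX))) ⟩
          ∑ U (λ X → escaped (iter H t (δ H X)))
            ≤⟨ escape-total t ⟩
          fromℕ t *ℚ (r *ℚ fromℕ B) ∎

      -- The 2 in `2 * k` is the laziness factor in the denominator of `ratio`; with `k = 2 ^ d` it
      -- accounts for the exponent `d + 1` in the theorem.
      conductance≤ : ∀ {a k} → 1 ≤ k → crossings H u * k ≤ N * (a * card u) → conductance H ≤ℚ fromℕ a *ℚ recip (2 * k)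
      conductance≤ {a} {k} 1≤k h = begin
        conductance H
          ≤⟨ minimum-≤ (Memₚ.∈-map⁺ (ratio H) (∈-select⁺ (admissible H) (select∈sublists u⇒P2 (allSubsets N)) U-admissible)) ⟩
        fromℕ (boundary H U) *ℚ recip (2 * N * card u)
          ≡⟨ cong (λ b → fromℕ b *ℚ recip (2 * N * card u)) (boundary-select H u) ⟩
        fromℕ (crossings H u) *ℚ recip (2 * N * card u)
          ≤⟨ fraction-≤ {crossings H u} {2 * N * card u} {a} {2 * k}
               (ℕₚ.*-mono-≤ (ℕₚ.≤-trans 1≤N (ℕₚ.m≤m+n N _)) 1≤u) (ℕₚ.≤-trans 1≤k (ℕₚ.m≤m+n k _)) cross-multiplied ⟩
        fromℕ a *ℚ recip (2 * k) ∎
        where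
        open ℚₚ.≤-Reasoning
        minimum-≤ : ∀ {q qs} → q ∈ qs → List.foldr _⊓_ 1ℚ qs ≤ℚ q
        minimum-≤ {qs = q' ∷ qs} (here refl) = ℚₚ.p⊓q≤p q' _
        minimum-≤ {qs = q' ∷ qs} (there q∈)  = ℚₚ.≤-trans (ℚₚ.p⊓q≤q q' _) (minimum-≤ q∈)
        U-admissible : admissible H U ≡ true
        U-admissible = cong₂ _∧_ (cong not (¬-not (λ e → ℕₚ.<⇒≢ 1≤u (sym (isYes-true⁻ (card u ℕ.≟ 0) e)))))
          (isYes-true⁺ (2 * card u ℕ.≤? length (P2 H)) 2u≤P2)
        cross-multiplied : crossings H u * (2 * k) ≤ a * (2 * N * card u)
        cross-multiplied = subst₂ _≤_
          (solve 2 (λ b k → con 2 :* (b :* k) := b :* (con 2 :* k)) refl (crossings H u) k)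
          (solve 3 (λ n a u → con 2 :* (n :* (a :* u)) := a :* (con 2 :* n :* u)) refl N a (card u))
          (ℕₚ.*-monoʳ-≤ 2 h)
          where open +-*-Solver

-- The bottleneck of the doubled star

-- The field `few-crossings` is the bound `(d + 1) / 2 ^ d` on the boundary divided by
-- `size H * card states`, cross-multiplied to stay in the naturals and still without the laziness
-- factor 2.
record Bottleneck (H : Graph) (d : ℕ) : Set where
  field
    states        : VSet (size H) → Bool
    states⇒P2     : ∀ A → states A ≡ true → InP2 H A
    nonempty      : 1 ≤ card states
    at-most-half  : 2 * card states ≤ length (P2 H)
    few-crossings : crossings H states * 2 ^ d ≤ size H * (suc d * card states)

card-disjoint : ∀ {N} {f g h : VSet N → Bool} → (∀ A → f A ≡ true → h A ≡ true) → (∀ A → g A ≡ true → h A ≡ true) →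
  (∀ A → f A ≡ true → ¬ g A ≡ true) → card f + card g ≤ card h
card-disjoint {N} {f} {g} {h} f⇒h g⇒h disjoint = ℕₚ.≤-trans
  (ℕₚ.+-mono-≤ (count-mono (λ A e → cong₂ _∧_ (f⇒h A e) e) (allSubsets N))
    (count-mono (λ A e → cong₂ _∧_ (g⇒h A e) (cong not (¬-not λ fA → disjoint A fA e))) (allSubsets N)))
  (ℕₚ.≤-reflexive (sym (count-split h f (allSubsets N))))

doubled-star-bottleneck : ∀ G {P Q} → InP2 G P → InP2 G Q → P ≢ Q → BlocksNonempty G P → BlocksNonempty G Q →
  ∀ d → 1 ≤ d → Bottleneck (D d G) d
doubled-star-bottleneck G {P} {Q} pP pQ P≢Q neP neQ d 1≤d = smaller (ℕₚ.≤-total (card FP.fibre) (card FQ.fibre))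
  where
  module FP = Fibre G d P pP neP
  module FQ = Fibre G d Q pQ neQ
  open ℕₚ.≤-Reasoning
  i₀ : Fin d
  i₀ = Fin.fromℕ< 1≤d
  both : card FP.fibre + card FQ.fibre ≤ length (P2 (D d G))
  both = card-disjoint {f = FP.fibre} {FQ.fibre} {isP2 (D d G)} (λ A → proj₁ ∘ FP.fibre⁻ {A}) (λ A → proj₁ ∘ FQ.fibre⁻ {A})
    λ A eP eQ → P≢Q (trans (sym (proj₂ (FP.fibre⁻ {A} eP))) (proj₂ (FQ.fibre⁻ {A} eQ)))
  smaller : card FP.fibre ≤ card FQ.fibre ⊎ card FQ.fibre ≤ card FP.fibre → Bottleneck (D d G) d
  smaller (inj₁ P≤Q) = record
    { states        = FP.fibre
    ; states⇒P2     = λ A → proj₁ ∘ FP.fibre⁻ {A}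
    ; nonempty      = FP.fibre-nonempty i₀
    ; at-most-half  = ℕₚ.≤-trans (ℕₚ.+-monoʳ-≤ (card FP.fibre) (ℕₚ.≤-trans (ℕₚ.≤-reflexive (ℕₚ.+-identityʳ _)) P≤Q)) both
    ; few-crossings = FP.crossings-bound }
  smaller (inj₂ Q≤P) = record
    { states        = FQ.fibre
    ; states⇒P2     = λ A → proj₁ ∘ FQ.fibre⁻ {A}
    ; nonempty      = FQ.fibre-nonempty i₀
    ; at-most-half  = ℕₚ.≤-trans (ℕₚ.+-mono-≤ Q≤P (ℕₚ.≤-reflexive (ℕₚ.+-identityʳ _))) both
    ; few-crossings = FQ.crossings-bound }

-- From the bottleneck to conductance, mixing time and torpid mixing

1≤2^ : ∀ k → 1 ≤ 2 ^ k
1≤2^ k = ℕₚ.m^n>0 2 k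

module Consequences (H : Graph) (1≤N : 1 ≤ size H) {d : ℕ} (bottleneck : Bottleneck H d) where
  open Bottleneck bottleneck
  open Walk-on H 1≤N
  open Escape states states⇒P2
  open Balanced nonempty at-most-half

  bottleneck⇒conductance : conductance H ≤ℚ fromℕ (suc d) *ℚ recip (2 ^ suc d)
  bottleneck⇒conductance = conductance≤ {suc d} {2 ^ d} (1≤2^ d) few-crossings

  -- The crossings grow with the number of vertices that can be flipped, but each vertex is picked
  -- with probability `1 / (2 * size H)`. So `size H` cancels together with `card states`, and a
  -- bound in `d` alone remains.
  bottleneck⇒slow : ∀ t → MixedBy H (recip 4) t → 2 ^ d ≤ 2 * (t * suc d)
  bottleneck⇒slow t mixed = ℕₚ.*-cancelˡ-≤ (card states * size H) {{ℕ.>-nonZero (ℕₚ.*-mono-≤ nonempty 1≤N)}} (begin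
    card states * size H * 2 ^ d
      ≤⟨ ℕₚ.*-monoˡ-≤ (2 ^ d) (mixed⇒slow t mixed) ⟩
    2 * (t * crossings H states) * 2 ^ d
      ≡⟨ solve 3 (λ t b k → con 2 :* (t :* b) :* k := con 2 :* t :* (b :* k)) refl t (crossings H states) (2 ^ d) ⟩
    2 * t * (crossings H states * 2 ^ d)
      ≤⟨ ℕₚ.*-monoʳ-≤ (2 * t) few-crossings ⟩
    2 * t * (size H * (suc d * card states))
      ≡⟨ solve 4 (λ t n e a → con 2 :* t :* (n :* (e :* a)) := a :* n :* (con 2 :* (t :* e))) refl t (size H) (suc d) (card states) ⟩
    card states * size H * (2 * (t * suc d)) ∎)
    where
    open ℕₚ.≤-Reasoning
    open +-*-Solver

-- The induction step is `(e + 1)² ≤ 2 * e²`, which is true from `e = 3` on; hence three base cases.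
-- The constant 4 is a power of two above the largest ratio 9/4, reached at `d = 2`.
linear²≤exponential : ∀ d → suc d * suc d ≤ 4 * 2 ^ d
linear²≤exponential 0 = s≤s z≤n
linear²≤exponential 1 = ℕₚ.m≤m+n 4 4
linear²≤exponential 2 = ℕₚ.m≤m+n 9 7
linear²≤exponential (suc (suc (suc d))) = begin
  (4 + d) * (4 + d)
    ≤⟨ ℕₚ.m≤m+n _ (2 + 4 * d + d * d) ⟩
  (4 + d) * (4 + d) + (2 + 4 * d + d * d)
    ≡⟨ solve 1 (λ d → (con 4 :+ d) :* (con 4 :+ d) :+ (con 2 :+ con 4 :* d :+ d :* d) := con 2 :* ((con 3 :+ d) :* (con 3 :+ d))) refl d ⟩
  2 * ((3 + d) * (3 + d))
    ≤⟨ ℕₚ.*-monoʳ-≤ 2 (linear²≤exponential (suc (suc d))) ⟩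
  2 * (4 * 2 ^ (2 + d))
    ≡⟨ solve 1 (λ k → con 2 :* (con 4 :* k) := con 4 :* (con 2 :* k)) refl (2 ^ (2 + d)) ⟩
  4 * 2 ^ (3 + d) ∎
  where
  open ℕₚ.≤-Reasoning
  open +-*-Solver

-- Squaring the hypothesis gives `2 ^ d` twice on the left; one copy pays for the polynomial factor
-- `(d + 1)²`.
slow⇒square : ∀ {d t} → 2 ^ d ≤ 2 * (t * suc d) → 2 ^ d ≤ 16 * (t * t)
slow⇒square {d} {t} h = ℕₚ.*-cancelˡ-≤ (2 ^ d) {{ℕ.>-nonZero (1≤2^ d)}} (begin
  2 ^ d * 2 ^ d
    ≤⟨ ℕₚ.*-mono-≤ h h ⟩
  2 * (t * suc d) * (2 * (t * suc d))
    ≡⟨ solve 2 (λ t e → con 2 :* (t :* e) :* (con 2 :* (t :* e)) := con 4 :* (t :* t) :* (e :* e)) refl t (suc d) ⟩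
  4 * (t * t) * (suc d * suc d)
    ≤⟨ ℕₚ.*-monoʳ-≤ (4 * (t * t)) (linear²≤exponential d) ⟩
  4 * (t * t) * (4 * 2 ^ d)
    ≡⟨ solve 2 (λ t k → con 4 :* (t :* t) :* (con 4 :* k) := k :* (con 16 :* (t :* t))) refl t (2 ^ d) ⟩
  2 ^ d * (16 * (t * t)) ∎)
  where
  open ℕₚ.≤-Reasoning
  open +-*-Solver

^-distribʳ-* : ∀ a b k → (a * b) ^ k ≡ a ^ k * b ^ k
^-distribʳ-* a b zero    = refl
^-distribʳ-* a b (suc k) = trans (cong (a * b *_) (^-distribʳ-* a b k))
  (solve 4 (λ a b p q → a :* b :* (p :* q) := a :* p :* (b :* q)) refl a b (a ^ k) (b ^ k))
  where open +-*-Solver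

-- The exponent `m` is raised to `suc m` so that the power of `t` is positive even for `m = 0`, as
-- `TorpidFamily` demands. The term `4 * suc m` comes from `16 = 2 ^ 4`.
states-bound : ∀ n m {d t} → 2 ^ d ≤ 16 * (t * t) → 2 ^ (n + m * d) ≤ t ^ (2 * suc m) * 2 ^ (n + 4 * suc m)
states-bound n m {d} {t} h = begin
  2 ^ (n + m * d)
    ≤⟨ ℕₚ.^-monoʳ-≤ 2 (ℕₚ.+-monoʳ-≤ n (ℕₚ.≤-trans (ℕₚ.m≤n+m (m * d) d) (ℕₚ.≤-reflexive (ℕₚ.*-comm (suc m) d)))) ⟩
  2 ^ (n + d * suc m)
    ≡⟨ trans (ℕₚ.^-distribˡ-+-* 2 n (d * suc m)) (cong (2 ^ n *_) (sym (ℕₚ.^-*-assoc 2 d (suc m)))) ⟩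
  2 ^ n * (2 ^ d) ^ suc m
    ≤⟨ ℕₚ.*-monoʳ-≤ (2 ^ n) (ℕₚ.^-monoˡ-≤ (suc m) h) ⟩
  2 ^ n * (16 * (t * t)) ^ suc m
    ≡⟨ cong (2 ^ n *_) (trans (^-distribʳ-* 16 (t * t) (suc m)) (cong₂ _*_ (ℕₚ.^-*-assoc 2 4 (suc m))
         (trans (cong (λ s → (t * s) ^ suc m) (sym (ℕₚ.*-identityʳ t))) (ℕₚ.^-*-assoc t 2 (suc m))))) ⟩
  2 ^ n * (2 ^ (4 * suc m) * t ^ (2 * suc m))
    ≡⟨ solve 3 (λ a b c → a :* (b :* c) := c :* (a :* b)) refl (2 ^ n) (2 ^ (4 * suc m)) (t ^ (2 * suc m)) ⟩
  t ^ (2 * suc m) * (2 ^ n * 2 ^ (4 * suc m))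
    ≡⟨ cong (t ^ (2 * suc m) *_) (sym (ℕₚ.^-distribˡ-+-* 2 n (4 * suc m))) ⟩
  t ^ (2 * suc m) * 2 ^ (n + 4 * suc m) ∎
  where
  open ℕₚ.≤-Reasoning
  open +-*-Solver

P2≤2^size : ∀ H → length (P2 H) ≤ 2 ^ size H
P2≤2^size H = ℕₚ.≤-trans (Listₚ.length-filter (λ A → isP2 H A ≟ᵇ true) (allSubsets (size H)))
  (ℕₚ.≤-reflexive (length-allSubsets (size H)))

-- Without parallel edges, an edge is determined by the ordered pair of its ends.
edges≤size² : ∀ G → NoMultiEdges G → length (edges G) ≤ size G * size G
edges≤size² G noMulti = Finₚ.injective⇒≤ {f = endpoints} injective
  where
  endpoints : Fin (length (edges G)) → Fin (size G * size G)
  endpoints j = combine (proj₁ (List.lookup (edges G) j)) (proj₂ (List.lookup (edges G) j))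
  injective : ∀ {i j} → endpoints i ≡ endpoints j → i ≡ j
  injective {i} {j} e with i Finₚ.≟ j
  ... | yes i≡j = i≡j
  ... | no i≢j  = ⊥-elim (proj₁ (noMulti i j i≢j) (Finₚ.combine-injective _ _ _ _ e))

0<recip : ∀ {k} → 1 ≤ k → 0ℚ <ℚ recip k
0<recip {suc k} _ = ℚₚ.positive⁻¹ (recip (suc k)) {{ℚₚ.normalize-pos 1 (suc k)}}

mainTheorem13 : (G : Graph) → Simple G → TwoConnected G
    → (Σ (VSet (size G)) λ P → Σ (VSet (size G)) λ Q →
    InP2 G P × InP2 G Q × ¬ (P ≡ Q) × BlocksNonempty G P × BlocksNonempty G Q)
    → TorpidFamily (λ d → D d G)
    × (∀ d → 1 ≤ d →
    (conductance (D d G) ≤ℚ (fromℕ (suc d) *ℚ recip (2 ^ suc d)))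
    × MixingTimeAtLeast (D d G) (recip 4) (fromℕ (2 ^ (d ∸ 1)) *ℚ recip (suc d))
    × (length (P2 (D d G)) ≤ 2 ^ size (D d G))
    × (2 ^ size (D d G) ≤ 2 ^ (size G + d * (size G * size G))))
mainTheorem13 G (_ , noMulti) (3≤n , _) (P , Q , pP , pQ , P≢Q , neP , neQ) = torpid , λ d 1≤d →
    Consequences.bottleneck⇒conductance (D d G) (1≤N d) (bottleneck d 1≤d)
  , mixing-time d 1≤d
  , P2≤2^size (D d G)
  , ℕₚ.^-monoʳ-≤ 2 (ℕₚ.+-monoʳ-≤ n (ℕₚ.≤-trans (ℕₚ.*-monoˡ-≤ d (edges≤size² G noMulti)) (ℕₚ.≤-reflexive (ℕₚ.*-comm (n * n) d))))
  where
  n m : ℕ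
  n = size G
  m = length (edges G)

  1≤N : ∀ d → 1 ≤ size (D d G)
  1≤N d = ℕₚ.≤-trans (s≤s z≤n) (ℕₚ.≤-trans 3≤n (ℕₚ.m≤m+n n (m * d)))

  bottleneck : ∀ d → 1 ≤ d → Bottleneck (D d G) d
  bottleneck = doubled-star-bottleneck G pP pQ P≢Q neP neQ

  slow : ∀ d → 1 ≤ d → ∀ t → MixedBy (D d G) (recip 4) t → 2 ^ d ≤ 2 * (t * suc d)
  slow d 1≤d = Consequences.bottleneck⇒slow (D d G) (1≤N d) (bottleneck d 1≤d)

  mixing-time : ∀ d → 1 ≤ d → MixingTimeAtLeast (D d G) (recip 4) (fromℕ (2 ^ (d ∸ 1)) *ℚ recip (suc d))
  -- Matching on `suc d` makes `d ∸ 1` compute, and the 2 in `slow` cancels one factor of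
  -- `2 ^ suc d`.
  mixing-time (suc d) 1≤d t mixed = ℚₚ.≤-trans
    (fraction-≤ {2 ^ d} {suc (suc d)} {t} {1} (s≤s z≤n) (s≤s z≤n)
      (ℕₚ.≤-trans (ℕₚ.≤-reflexive (ℕₚ.*-identityʳ (2 ^ d))) (ℕₚ.*-cancelˡ-≤ 2 (slow (suc d) 1≤d t mixed))))
    (ℚₚ.≤-reflexive (ℚₚ.*-identityʳ (fromℕ t)))

  torpid : TorpidFamily (λ d → D d G)
  -- Both witnesses depend on `G` only: `k` is the power of `t` in `states-bound`, and `c` is the
  -- inverse of the constant factor there.
  torpid = 2 * suc m , recip (2 ^ (n + 4 * suc m)) , s≤s z≤n , 0<recip (1≤2^ (n + 4 * suc m)) , λ d 1≤d t mixed →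
    let square = slow⇒square {d} {t} (slow d 1≤d t mixed) in begin
    recip (2 ^ (n + 4 * suc m)) *ℚ fromℕ (length (P2 (D d G)))
      ≡⟨ ℚₚ.*-comm (recip (2 ^ (n + 4 * suc m))) (fromℕ (length (P2 (D d G)))) ⟩
    fromℕ (length (P2 (D d G))) *ℚ recip (2 ^ (n + 4 * suc m))
      ≤⟨ fraction-≤ {length (P2 (D d G))} {2 ^ (n + 4 * suc m)} {t ^ (2 * suc m)} {1} (1≤2^ (n + 4 * suc m)) (s≤s z≤n)
           (ℕₚ.≤-trans (ℕₚ.≤-reflexive (ℕₚ.*-identityʳ _)) (ℕₚ.≤-trans (P2≤2^size (D d G)) (states-bound n m {d} {t} square))) ⟩
    fromℕ (t ^ (2 * suc m)) *ℚ 1ℚ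
      ≡⟨ ℚₚ.*-identityʳ _ ⟩
    fromℕ (t ^ (2 * suc m)) ∎
    where open ℚₚ.≤-Reasoning
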